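{- For every integer $k\ge 5$, the graph $G_k$ obtained from the complete graph $K_k$ by subdividing every edge into a path of two edges satisfies $\bar\theta(G_k)=2$, where $\bar\theta$ denotes geometric thickness.
   Context: The graph $G_k$ is formed from the complete $k$-vertex graph $K_k$ by subdividing every edge into a path of two edges. Equivalently, the vertices of $G_k$ are the one-element and two-element subsets of a $k$-element set, with an edge between two distinct such subsets exactly when one is contained in the other. Thus $G_k$ has $k+\binom{k}{2}$ vertices and $2\binom{k}{2}$ edges. A straight-line drawing of a graph places the vertices at distinct points of the plane $\mathbb{R}^2$ and draws each edge as the straight line segment between the points representing its endpoints (with the usual convention that an edge passes through no vertex other than its own endpoints). Two edges cross if their segments share a point that is not a common endpoint of the two edges. The geometric thickness $\bar\theta(G)$ of a graph $G$ is the minimum number of layers in a straight-line drawing of $G$ in the plane in which each edge is assigned to a single layer and no two edges in the same layer cross. (Edges in different layers may cross; the vertex positions are the same for all layers.) -}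

module Defs where

open import Data.Fin.Base as Fin using (Fin)
import Data.Fin.Properties as Fin
import Data.Integer.Base as ℤ
open import Data.Nat.Base as ℕ using (ℕ)
import Data.Nat.Properties as ℕ
open import Data.Product.Base using (Σ-syntax; ∃-syntax; _×_; _,_; proj₁; proj₂)
open import Data.Rational.Base as ℚ using (ℚ; 0ℚ; 1ℚ; ½; ∣_∣)
import Data.Rational.Properties as ℚ
open import Data.Rational.Solver using (module +-*-Solver)
open import Data.Sum.Base using (_⊎_; inj₁; inj₂; [_,_])
open import Data.Sum.Properties using (inj₁-injective; inj₂-injective)
open import Function.Base using (_∘_; const; id)
open import Relation.Binary.PropositionalEquality
  using (_≡_; _≢_; refl; sym; trans; cong; cong₂; subst)
open import Relation.Nullary.Negation.Core using (¬_; contradiction)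

-- Real numbers: Cauchy sequences of rationals, considered up to _≈_.

module Real where

  IsCauchy : (ℕ → ℚ) → Set
  IsCauchy s = ∀ ε → 0ℚ ℚ.< ε →
    ∃[ N ] (∀ m n → N ℕ.≤ m → N ℕ.≤ n → ∣ s m ℚ.- s n ∣ ℚ.< ε)

  record ℝ : Set where
    constructor mkℝ
    field
      seq    : ℕ → ℚ
      cauchy : IsCauchy seq
  open ℝ public

  infix 4 _≈_ _≤_

  _≈_ : ℝ → ℝ → Set
  x ≈ y = ∀ ε → 0ℚ ℚ.< ε →
    ∃[ N ] (∀ n → N ℕ.≤ n → ∣ seq x n ℚ.- seq y n ∣ ℚ.< ε)

  _≤_ : ℝ → ℝ → Set
  x ≤ y = ∀ ε → 0ℚ ℚ.< ε →
    ∃[ N ] (∀ n → N ℕ.≤ n → seq x n ℚ.- seq y n ℚ.< ε)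

  private
    open +-*-Solver using (solve; _:+_; _:*_; _:-_; :-_; con; _:=_)

    half-pos : ∀ {ε} → 0ℚ ℚ.< ε → 0ℚ ℚ.< ½ ℚ.* ε
    half-pos {ε} ε>0 =
      ℚ.positive⁻¹ (½ ℚ.* ε) {{ℚ.pos*pos⇒pos ½ ε {{ℚ.positive ε>0}}}}

    halves : ∀ ε → ½ ℚ.* ε ℚ.+ ½ ℚ.* ε ≡ ε
    halves = solve 1 (λ e → con ½ :* e :+ con ½ :* e := e) refl

    ∣+∣-< : ∀ p q {a b} → ∣ p ∣ ℚ.< a → ∣ q ∣ ℚ.< b → ∣ p ℚ.+ q ∣ ℚ.< a ℚ.+ b
    ∣+∣-< p q p<a q<b =
      ℚ.≤-<-trans (ℚ.∣p+q∣≤∣p∣+∣q∣ p q) (ℚ.+-mono-< p<a q<b)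

    ∣*∣-< : ∀ p q {a b} → ℚ.Positive a →
            ∣ p ∣ ℚ.< a → ∣ q ∣ ℚ.< b → ∣ p ℚ.* q ∣ ℚ.< a ℚ.* b
    ∣*∣-< p q {a} {b} a>0 p<a q<b = begin-strict
      ∣ p ℚ.* q ∣       ≡⟨ ℚ.∣p*q∣≡∣p∣*∣q∣ p q ⟩
      ∣ p ∣ ℚ.* ∣ q ∣   ≤⟨ ℚ.*-monoʳ-≤-nonNeg ∣ q ∣ {{ℚ.∣-∣-nonNeg q}} (ℚ.<⇒≤ p<a) ⟩
      a ℚ.* ∣ q ∣       <⟨ ℚ.*-monoʳ-<-pos a {{a>0}} q<b ⟩
      a ℚ.* b           ∎
      where open ℚ.≤-Reasoning

    bound : ∀ {s} → IsCauchy s →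
            ∃[ B ] ℚ.Positive B × ∃[ N ] (∀ n → N ℕ.≤ n → ∣ s n ∣ ℚ.< B)
    bound {s} c with c 1ℚ (ℚ.positive⁻¹ 1ℚ)
    ... | N , close = B , B>0 , N , below
      where
      B : ℚ
      B = 1ℚ ℚ.+ ∣ s N ∣

      B>0 : ℚ.Positive B
      B>0 = ℚ.pos+nonNeg⇒pos 1ℚ ∣ s N ∣ {{ℚ.∣-∣-nonNeg (s N)}}

      below : ∀ n → N ℕ.≤ n → ∣ s n ∣ ℚ.< B
      below n N≤n = begin-strict
        ∣ s n ∣                          ≡⟨ cong ∣_∣ (solve 2 (λ a b → a := (a :- b) :+ b) refl (s n) (s N)) ⟩
        ∣ (s n ℚ.- s N) ℚ.+ s N ∣        ≤⟨ ℚ.∣p+q∣≤∣p∣+∣q∣ (s n ℚ.- s N) (s N) ⟩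
        ∣ s n ℚ.- s N ∣ ℚ.+ ∣ s N ∣      <⟨ ℚ.+-monoˡ-< ∣ s N ∣ (close n N N≤n ℕ.≤-refl) ⟩
        B                                ∎
        where open ℚ.≤-Reasoning

    quotient : ∀ B → ℚ.Positive B → ∀ {η} → 0ℚ ℚ.< η →
               ∃[ δ ] 0ℚ ℚ.< δ × B ℚ.* δ ≡ η
    quotient B B>0 {η} η>0 =
      B⁻¹ ℚ.* η ,
      ℚ.positive⁻¹ _ {{ℚ.pos*pos⇒pos B⁻¹ {{ℚ.1/pos⇒pos B {{B>0}}}} η {{ℚ.positive η>0}}}} ,
      trans (sym (ℚ.*-assoc B B⁻¹ η))
        (trans (cong (ℚ._* η) (ℚ.*-inverseʳ B {{ℚ.pos⇒nonZero B {{B>0}}}})) (ℚ.*-identityˡ η))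
      where
      B⁻¹ : ℚ
      B⁻¹ = ℚ.1/_ B {{ℚ.pos⇒nonZero B {{B>0}}}}

    *-close : ∀ a b c d {B C δ γ} → ℚ.Positive B → ℚ.Positive C →
              ∣ a ∣ ℚ.< B → ∣ d ∣ ℚ.< C → ∣ b ℚ.- d ∣ ℚ.< δ → ∣ a ℚ.- c ∣ ℚ.< γ →
              ∣ a ℚ.* b ℚ.- c ℚ.* d ∣ ℚ.< B ℚ.* δ ℚ.+ C ℚ.* γ
    *-close a b c d {B} {C} {δ} {γ} B>0 C>0 a<B d<C bd<δ ac<γ =
      subst (λ x → ∣ x ∣ ℚ.< B ℚ.* δ ℚ.+ C ℚ.* γ)
        (solve 4 (λ a b c d → a :* (b :- d) :+ d :* (a :- c) := a :* b :- c :* d) refl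
          a b c d)
        (∣+∣-< (a ℚ.* (b ℚ.- d)) (d ℚ.* (a ℚ.- c))
          (∣*∣-< a (b ℚ.- d) B>0 a<B bd<δ) (∣*∣-< d (a ℚ.- c) C>0 d<C ac<γ))

    abstract
      const-cauchy : ∀ q → IsCauchy (const q)
      const-cauchy q ε ε>0 =
        0 , λ _ _ _ _ → subst (ℚ._< ε) (sym (cong ∣_∣ (ℚ.+-inverseʳ q))) ε>0

      +-cauchy : ∀ {s t} → IsCauchy s → IsCauchy t → IsCauchy (λ n → s n ℚ.+ t n)
      +-cauchy {s} {t} cs ct ε ε>0
        with cs (½ ℚ.* ε) (half-pos ε>0) | ct (½ ℚ.* ε) (half-pos ε>0)
      ... | M , p | N , q = M ℕ.⊔ N , λ m n m≥ n≥ → begin-strict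
        ∣ (s m ℚ.+ t m) ℚ.- (s n ℚ.+ t n) ∣
          ≡⟨ cong ∣_∣ (solve 4 (λ a b c d → (a :+ b) :- (c :+ d) := (a :- c) :+ (b :- d)) refl
                        (s m) (t m) (s n) (t n)) ⟩
        ∣ (s m ℚ.- s n) ℚ.+ (t m ℚ.- t n) ∣
          <⟨ ∣+∣-< (s m ℚ.- s n) (t m ℚ.- t n)
               (p m n (ℕ.m⊔n≤o⇒m≤o M N m≥) (ℕ.m⊔n≤o⇒m≤o M N n≥))
               (q m n (ℕ.m⊔n≤o⇒n≤o M N m≥) (ℕ.m⊔n≤o⇒n≤o M N n≥)) ⟩
        ½ ℚ.* ε ℚ.+ ½ ℚ.* ε ≡⟨ halves ε ⟩
        ε ∎
        where open ℚ.≤-Reasoning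

      neg-cauchy : ∀ {s} → IsCauchy s → IsCauchy (λ n → ℚ.- s n)
      neg-cauchy {s} cs ε ε>0 with cs ε ε>0
      ... | N , p = N , λ m n m≥ n≥ →
        subst (ℚ._< ε)
          (cong ∣_∣ (solve 2 (λ a b → b :- a := (:- a) :- (:- b)) refl (s m) (s n)))
          (p n m n≥ m≥)

      *-cauchy : ∀ {s t} → IsCauchy s → IsCauchy t → IsCauchy (λ n → s n ℚ.* t n)
      *-cauchy {s} {t} cs ct ε ε>0 =
        let B , B>0 , M₁ , s<B = bound {s} cs
            C , C>0 , N₁ , t<C = bound {t} ct
            δ , δ>0 , Bδ≡      = quotient B B>0 (half-pos ε>0)
            γ , γ>0 , Cγ≡      = quotient C C>0 (half-pos ε>0)
            M₂ , p             = cs γ γ>0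
            N₂ , q             = ct δ δ>0
            M = M₁ ℕ.⊔ M₂
            N = N₁ ℕ.⊔ N₂
        in M ℕ.⊔ N , λ m n m≥ n≥ →
          let m≥M = ℕ.m⊔n≤o⇒m≤o M N m≥ ; m≥N = ℕ.m⊔n≤o⇒n≤o M N m≥
              n≥M = ℕ.m⊔n≤o⇒m≤o M N n≥ ; n≥N = ℕ.m⊔n≤o⇒n≤o M N n≥
          in subst (∣ s m ℚ.* t m ℚ.- s n ℚ.* t n ∣ ℚ.<_)
            (trans (cong₂ ℚ._+_ Bδ≡ Cγ≡) (halves ε))
            (*-close (s m) (t m) (s n) (t n) B>0 C>0
              (s<B m (ℕ.m⊔n≤o⇒m≤o M₁ M₂ m≥M))
              (t<C n (ℕ.m⊔n≤o⇒m≤o N₁ N₂ n≥N))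
              (q m n (ℕ.m⊔n≤o⇒n≤o N₁ N₂ m≥N) (ℕ.m⊔n≤o⇒n≤o N₁ N₂ n≥N))
              (p m n (ℕ.m⊔n≤o⇒n≤o M₁ M₂ m≥M) (ℕ.m⊔n≤o⇒n≤o M₁ M₂ n≥M)))

  infixl 6 _+_ _-_
  infixl 7 _*_
  infix  8 -_

  fromℚ : ℚ → ℝ
  fromℚ q = mkℝ (const q) (const-cauchy q)

  0ℝ 1ℝ : ℝ
  0ℝ = fromℚ 0ℚ
  1ℝ = fromℚ 1ℚ

  _+_ : ℝ → ℝ → ℝ
  x + y = mkℝ (λ n → seq x n ℚ.+ seq y n) (+-cauchy {seq x} {seq y} (cauchy x) (cauchy y))

  -_ : ℝ → ℝ
  - x = mkℝ (λ n → ℚ.- seq x n) (neg-cauchy {seq x} (cauchy x))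

  _-_ : ℝ → ℝ → ℝ
  x - y = x + (- y)

  _*_ : ℝ → ℝ → ℝ
  x * y = mkℝ (λ n → seq x n ℚ.* seq y n) (*-cauchy {seq x} {seq y} (cauchy x) (cauchy y))

open Real using (ℝ; 0ℝ; 1ℝ)

-- Simple graphs, with each undirected edge a single element of Edge; the
-- order of its two ends is only a choice of presentation.

record Graph : Set₁ where
  field
    Vertex    : Set
    Edge      : Set
    end₁ end₂ : Edge → Vertex
    loopless  : ∀ e → end₁ e ≢ end₂ e
    simple    : ∀ e f → (end₁ e ≡ end₁ f × end₂ e ≡ end₂ f) ⊎
                        (end₁ e ≡ end₂ f × end₂ e ≡ end₁ f) → e ≡ f

complete : ℕ → Graph
complete k = record
  { Vertex   = Fin k
  ; Edge     = Σ[ (i , j) ∈ Fin k × Fin k ] i Fin.< j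
  ; end₁     = proj₁ ∘ proj₁
  ; end₂     = proj₂ ∘ proj₁
  ; loopless = λ (_ , i<j) → Fin.<⇒≢ i<j
  ; simple   = λ where
      (_ , p) (_ , q) (inj₁ (refl , refl)) → cong (_ ,_) (Fin.<-irrelevant p q)
      (_ , p) (_ , q) (inj₂ (refl , refl)) → contradiction q (Fin.<-asym p)
  }

-- Every edge e becomes a new vertex inj₂ e and two edges: inj₁ e joins it
-- to end₁ e, and inj₂ e joins it to end₂ e.

subdivide : Graph → Graph
subdivide G = record
  { Vertex   = Vertex ⊎ Edge
  ; Edge     = Edge ⊎ Edge
  ; end₁     = inj₁ ∘ [ end₁ , end₂ ]
  ; end₂     = inj₂ ∘ [ id , id ]
  ; loopless = λ _ ()
  ; simple   = λ where
      e f (inj₂ (() , _))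
      (inj₁ e) (inj₁ f) (inj₁ (_ , q)) → cong inj₁ (inj₂-injective q)
      (inj₂ e) (inj₂ f) (inj₁ (_ , q)) → cong inj₂ (inj₂-injective q)
      (inj₁ e) (inj₂ f) (inj₁ (p , q)) → contradiction
        (trans (inj₁-injective p) (cong end₂ (sym (inj₂-injective q)))) (loopless e)
      (inj₂ e) (inj₁ f) (inj₁ (p , q)) → contradiction
        (trans (sym (inj₁-injective p)) (cong end₂ (inj₂-injective q))) (loopless f)
  }
  where open Graph G

Point : Set
Point = ℝ × ℝ

infix 4 _≈ₚ_

_≈ₚ_ : Point → Point → Set
(x , y) ≈ₚ (x′ , y′) = x Real.≈ x′ × y Real.≈ y′

OnSegment : Point → Point → Point → Set
OnSegment (ax , ay) (bx , by) p =
  ∃[ t ] 0ℝ Real.≤ t × t Real.≤ 1ℝ ×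
    p ≈ₚ ((1ℝ - t) * ax + t * bx , (1ℝ - t) * ay + t * by)
  where open Real using (_+_; _-_; _*_)

module _ (G : Graph) where
  open Graph G

  OnEdge : (Vertex → Point) → Edge → Point → Set
  OnEdge pos e = OnSegment (pos (end₁ e)) (pos (end₂ e))

  IsEnd : Vertex → Edge → Set
  IsEnd v e = v ≡ end₁ e ⊎ v ≡ end₂ e

  record Drawing : Set where
    field
      pos      : Vertex → Point
      distinct : ∀ u v → u ≢ v → ¬ pos u ≈ₚ pos v
      avoids   : ∀ e v → ¬ IsEnd v e → ¬ OnEdge pos e (pos v)

  Cross : Drawing → Edge → Edge → Set
  Cross D e f =
    ∃[ p ] OnEdge pos e p × OnEdge pos f p ×
      ¬ (∃[ v ] IsEnd v e × IsEnd v f × p ≈ₚ pos v)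
    where open Drawing D

  record LayeredDrawing (m : ℕ) : Set where
    field
      drawing   : Drawing
      layer     : Edge → Fin m
      noncross  : ∀ e f → e ≢ f → layer e ≡ layer f → ¬ Cross drawing e f

-- The minimum is given as a relation, since it need not be computable.

GeometricThickness : Graph → ℕ → Set
GeometricThickness G n = LayeredDrawing G n × (∀ m → LayeredDrawing G m → n ℕ.≤ m)

{-# OPTIONS --safe #-}
-- Upper bound.  Put the vertex i at (2i, -2i) and the subdivision vertex of the
-- edge ij, i < j, at (2i + 1, -2j + 1).  The halves at the smaller ends form fans
-- in disjoint vertical strips, those at the larger ends form fans in disjoint
-- horizontal strips.
--
-- Lower bound.  After a generic shear, assign to segments ab and pq the parity of
-- the number of ends of pq vertically below ab plus the number of ends of ab
-- vertically above pq; it is even for disjoint segments.  Summed over all pairs of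
-- independent edges of K₅, each drawn as a path of two segments, the bends cancel
-- and the vertices contribute an odd number, so two independent edges meet.
module Submission where

open import Defs
open import Data.Nat.Base using (ℕ; _≤_)
open import Data.Bool.Base using (Bool; true; false; not; _∧_; _xor_)
open import Data.Bool.Properties using (xor-comm; xor-identityʳ; xor-same) renaming (_≟_ to _≟ᵇ_)
open import Data.Bool.Solver using (module xor-∧-Solver)
open import Data.Empty using (⊥)
open import Data.Fin.Base as Fin using (Fin; toℕ; _↑ˡ_)
open import Data.Fin.Patterns using (0F; 1F; 2F; 3F; 4F)
import Data.Fin.Properties as Fin
open import Data.Nat.Base as ℕ using (zero; suc; z≤n; s≤s)
import Data.Nat.Properties as ℕ
open import Data.Product.Base using (∃-syntax; _×_; _,_; proj₁; proj₂; swap)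
open import Data.Rational.Base as ℚ using (ℚ; 0ℚ; 1ℚ; ½; ∣_∣)
import Data.Rational.Properties as ℚ
open import Data.Rational.Solver using (module +-*-Solver)
open import Data.Sum.Base using (_⊎_; inj₁; inj₂; [_,_])
open import Data.Sum.Properties using (inj₁-injective)
open import Function.Base using (_∘_; _$_; const)
open import Relation.Binary.Definitions using (DecidableEquality; tri<; tri≈; tri>)
open import Relation.Binary.PropositionalEquality
  using (_≡_; _≢_; refl; sym; trans; cong; cong₂; subst; subst₂)
open import Relation.Nullary using (¬_; Dec; yes; no; does; contradiction)
open import Relation.Nullary.Decidable
  using (True; toWitness; dec-true; dec-false; _×-dec_; ¬?)
open import Algebra.Properties.Group ℚ.+-0-group using (∙-cancelʳ; ⁻¹-involutive; x∙y⁻¹≈ε⇒x≈y)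

open Real using (ℝ; mkℝ; seq; cauchy; IsCauchy; fromℚ)

-- Crossing parities

-- The parity stands in for the Jordan curve theorem: it depends on finitely many orientation signs,
-- so the nonplanarity of K₅ reduces to xor identities. The sum over the fifteen independent pairs
-- is arranged around one vertex `h` and the K₄ on the other four. The triangles of that K₄ cover
-- `h` an even number of times, whereas an odd number of its vertices lie inside the triangle of the
-- other three; the edges at `h` would force these two parities to agree. The oddness comes from the
-- order of the levels: rewriting `U` through `O` leaves three pairs of opposite comparisons, and
-- each pair contributes 1. In the drawing, the original vertices lie on the antidiagonal and every
-- bend is displaced by 1 in both coordinates. Exchanging the coordinates therefore turns the second
-- family of fans into one of the same shape as the first, and one lemma about fans serves both
-- layers.

module XorIdentities where
  open xor-∧-Solver using (solve; _:+_; _:=_; con)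

  -- The terms that test one bend against a segment at the other bend, `iab`, `jab`, `kba` and
  -- `lba`, occur twice on the right.
  bends-cancel : ∀ iak iab ial jak jab jal kbi kba kbj lbi lba lbj →
    ((iak xor jak) xor (ial xor jal)) xor ((kbi xor lbi) xor (kbj xor lbj)) ≡
    (((iak xor iab) xor (kbi xor kba)) xor ((ial xor iab) xor (lbi xor lba))) xor
    (((jak xor jab) xor (kbj xor kba)) xor ((jal xor jab) xor (lbj xor lba)))
  bends-cancel = solve 12 (λ iak iab ial jak jab jal kbi kba kbj lbi lba lbj →
    ((iak :+ jak) :+ (ial :+ jal)) :+ ((kbi :+ lbi) :+ (kbj :+ lbj)) :=
    (((iak :+ iab) :+ (kbi :+ kba)) :+ ((ial :+ iab) :+ (lbi :+ lba))) :+
    (((jak :+ jab) :+ (kbj :+ kba)) :+ ((jal :+ jab) :+ (lbj :+ lba)))) refl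

  bend-cancels : ∀ u v i j a →
    (u xor (i xor a)) xor (v xor (j xor a)) ≡ (u xor v) xor (i xor j)
  bend-cancels = solve 5 (λ u v i j a →
    (u :+ (i :+ a)) :+ (v :+ (j :+ a)) := (u :+ v) :+ (i :+ j)) refl

  triangle : ∀ k l m a b c a′ b′ c′ →
    (a xor (b xor c)) xor (a′ xor (b′ xor c′)) ≡
    ((k xor l) xor (a xor a′)) xor
    (((k xor m) xor (b xor b′)) xor ((l xor m) xor (c xor c′)))
  triangle = solve 9 (λ k l m a b c a′ b′ c′ →
    (a :+ (b :+ c)) :+ (a′ :+ (b′ :+ c′)) :=
    ((k :+ l) :+ (a :+ a′)) :+ (((k :+ m) :+ (b :+ b′)) :+ ((l :+ m) :+ (c :+ c′)))) refl

  -- The three sums for opposite edges contain each of the twelve edge-vertex terms once. Their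
  -- level terms `ij`, `ik`, `il` cancel in pairs, and the six left over are the ones added in the
  -- last line.
  tetrahedron : ∀ ijk ijl ikj ikl ilj ilk jki jkl jli jlk kli klj ij ik il jk jl kl kj lj lk →
    ((ijl xor (ikl xor jkl)) xor (ijk xor (ilk xor jlk))) xor
    ((ikj xor (ilj xor klj)) xor (jki xor (jli xor kli))) ≡
    ((((ijk xor (ik xor jk)) xor (ijl xor (il xor jl))) xor (kli xor klj)) xor
     ((((ikj xor (ij xor kj)) xor (ikl xor (il xor kl))) xor (jli xor jlk)) xor
      (((ilj xor (ij xor lj)) xor (ilk xor (ik xor lk))) xor (jki xor jkl)))) xor
    ((kj xor jk) xor ((lj xor jl) xor (lk xor kl)))
  tetrahedron = solve 21 (λ ijk ijl ikj ikl ilj ilk jki jkl jli jlk kli klj ij ik il jk jl kl kj lj lk →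
    ((ijl :+ (ikl :+ jkl)) :+ (ijk :+ (ilk :+ jlk))) :+
    ((ikj :+ (ilj :+ klj)) :+ (jki :+ (jli :+ kli))) :=
    ((((ijk :+ (ik :+ jk)) :+ (ijl :+ (il :+ jl))) :+ (kli :+ klj)) :+
     ((((ikj :+ (ij :+ kj)) :+ (ikl :+ (il :+ kl))) :+ (jli :+ jlk)) :+
      (((ilj :+ (ij :+ lj)) :+ (ilk :+ (ik :+ lk))) :+ (jki :+ jkl)))) :+
    ((kj :+ jk) :+ ((lj :+ jl) :+ (lk :+ kl)))) refl

  cover : ∀ ij ik il jk jl kl →
    ((ij xor (ik xor jk)) xor (ij xor (il xor jl))) xor
    ((ik xor (il xor kl)) xor (jk xor (jl xor kl))) ≡ false
  cover = solve 6 (λ ij ik il jk jl kl →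
    ((ij :+ (ik :+ jk)) :+ (ij :+ (il :+ jl))) :+ ((ik :+ (il :+ kl)) :+ (jk :+ (jl :+ kl)))
    := con false) refl

  swap-roles : ∀ op oq ua ub ap bp aq bq pa qa pb qb →
    ((op xor (ap xor bp)) xor (oq xor (aq xor bq))) xor
    ((ua xor (pa xor qa)) xor (ub xor (pb xor qb))) ≡
    ((ua xor ub) xor (op xor oq)) xor
    (((ap xor pa) xor (aq xor qa)) xor ((bp xor pb) xor (bq xor qb)))
  swap-roles = solve 12 (λ op oq ua ub ap bp aq bq pa qa pb qb →
    ((op :+ (ap :+ bp)) :+ (oq :+ (aq :+ bq))) :+
    ((ua :+ (pa :+ qa)) :+ (ub :+ (pb :+ qb))) :=
    ((ua :+ ub) :+ (op :+ oq)) :+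
    (((ap :+ pa) :+ (aq :+ qa)) :+ ((bp :+ pb) :+ (bq :+ qb)))) refl

  each-twice : ∀ a b c d a′ b′ c′ d′ →
    (((a xor a′) xor (b xor b′)) xor ((c xor c′) xor (d xor d′))) xor
    (((a xor b) xor (c xor d)) xor ((a′ xor b′) xor (c′ xor d′))) ≡ false
  each-twice = solve 8 (λ a b c d a′ b′ c′ d′ →
    (((a :+ a′) :+ (b :+ b′)) :+ ((c :+ c′) :+ (d :+ d′))) :+
    (((a :+ b) :+ (c :+ d)) :+ ((a′ :+ b′) :+ (c′ :+ d′))) := con false) refl

open XorIdentities

false≢true : false ≢ true
false≢true ()

-- U i j p and O i j p: the parity of the number of times that the path ij passes
-- above, respectively below, the vertex p.  L i j: whether i is left of j.
module K₅ (U O : Fin 5 → Fin 5 → Fin 5 → Bool) (L : Fin 5 → Fin 5 → Bool)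
          (U≡O : ∀ i j p → U i j p ≡ O i j p xor (L i p xor L j p)) where

  -- The ray test for a point inside a closed curve: this counts, modulo 2, how often the downward
  -- ray from `p` meets the triangle.
  inside : Fin 5 → Fin 5 → Fin 5 → Fin 5 → Bool
  inside i j k p = O i j p xor (O i k p xor O j k p)

  Even : Fin 5 → Fin 5 → Fin 5 → Fin 5 → Set
  Even i j k l = (U i j k xor U i j l) xor (O k l i xor O k l j) ≡ false

  Opposite : Fin 5 → Fin 5 → Set
  Opposite i j = L i j xor L j i ≡ true

  -- In the sum over the three sides of the triangle, each of `U i j k`, `U i j l`, `U i j m` occurs
  -- twice and cancels.
  same-side : ∀ i j k l m → Even i j k l → Even i j k m → Even i j l m →
              inside k l m i xor inside k l m j ≡ false
  same-side i j k l m p q r =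
    trans
      (triangle (U i j k) (U i j l) (U i j m)
        (O k l i) (O k m i) (O l m i) (O k l j) (O k m j) (O l m j))
      (cong₂ _xor_ p (cong₂ _xor_ q r))

  even-over : ∀ i j k l → Even i j k l →
    ((O i j k xor (L i k xor L j k)) xor (O i j l xor (L i l xor L j l))) xor
    (O k l i xor O k l j) ≡ false
  even-over i j k l =
    trans (cong₂ (λ x y → (x xor y) xor (O k l i xor O k l j)) (sym (U≡O i j k)) (sym (U≡O i j l)))

  -- In a plane K₄ an odd number of vertices (in fact one) lie inside the
  -- triangle formed by the other three.
  K₄-odd : ∀ i j k l → Even i j k l → Even i k j l → Even i l j k →
           Opposite k j → Opposite l j → Opposite l k →
           (inside i j k l xor inside i j l k) xor (inside i k l j xor inside j k l i) ≡ true
  K₄-odd i j k l p q r kj lj lk =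
    trans
      (tetrahedron
        (O i j k) (O i j l) (O i k j) (O i k l) (O i l j) (O i l k)
        (O j k i) (O j k l) (O j l i) (O j l k) (O k l i) (O k l j)
        (L i j) (L i k) (L i l) (L j k) (L j l) (L k l) (L k j) (L l j) (L l k))
      (cong₂ _xor_
        (cong₂ _xor_ (even-over i j k l p) (cong₂ _xor_ (even-over i k j l q) (even-over i l j k r)))
        (cong₂ _xor_ kj (cong₂ _xor_ lj lk)))

  -- The four triangles of a K₄ cover every point off it an even number of times.
  cover-even : ∀ i j k l p →
    (inside i j k p xor inside i j l p) xor (inside i k l p xor inside j k l p) ≡ false
  cover-even i j k l p = cover (O i j p) (O i k p) (O i l p) (O j k p) (O j l p) (O k l p)

  -- Each of `i`, `j`, `k`, `l` is joined to `h` by a path of even parity with the triangle on the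
  -- other three, which therefore contains both ends or neither. Summed over the four triangles,
  -- this equates the even count at `h` with the odd count at the opposite vertices.
  K₅-nonplanar : ∀ h i j k l →
    Even h i j k → Even h i j l → Even h i k l →
    Even h j i k → Even h j i l → Even h j k l →
    Even h k i j → Even h k i l → Even h k j l →
    Even h l i j → Even h l i k → Even h l j k →
    Even i j k l → Even i k j l → Even i l j k →
    Opposite k j → Opposite l j → Opposite l k → ⊥
  K₅-nonplanar h i j k l i₁ i₂ i₃ j₁ j₂ j₃ k₁ k₂ k₃ l₁ l₂ l₃ p q r kj lj lk
    = false≢true (trans (sym (each-twice
      (inside i j k h) (inside i j l h) (inside i k l h) (inside j k l h)
      (inside i j k l) (inside i j l k) (inside i k l j) (inside j k l i))) (cong₂ _xor_
      (cong₂ _xor_ (cong₂ _xor_ (same-side h l i j k l₁ l₂ l₃) (same-side h k i j l k₁ k₂ k₃))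
                   (cong₂ _xor_ (same-side h j i k l j₁ j₂ j₃) (same-side h i j k l i₁ i₂ i₃)))
      (cong₂ _xor_ (cover-even i j k l h) (K₄-odd i j k l p q r kj lj lk))))

-- Parities of segments and of paths with one bend

record Path (V : Set) : Set where
  constructor path
  field start finish bend : V

module Parity {V : Set} (lt : V → V → Bool) (side : V → V → V → Bool) where

  open Path

  -- The xor tests whether the vertical line through `p` meets the segment `ab`; when it does,
  -- exactly one of the two holds, which is the source of `under≡over`.
  under over : V → V → V → Bool
  under a b p = (lt a p xor lt b p) ∧ side a b p
  over  a b p = (lt a p xor lt b p) ∧ not (side a b p)

  crossing : V → V → V → V → Bool
  crossing a b p q = (under a b p xor under a b q) xor (over p q a xor over p q b)

  under≡over : ∀ a b p → under a b p ≡ over a b p xor (lt a p xor lt b p)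
  under≡over a b p with lt a p | lt b p | side a b p
  ... | true  | true  | _     = refl
  ... | true  | false | true  = refl
  ... | true  | false | false = refl
  ... | false | true  | true  = refl
  ... | false | true  | false = refl
  ... | false | false | _     = refl

  under′ over′ : Path V → V → Bool
  under′ (path i j a) p = under i a p xor under j a p
  over′  (path i j a) p = over i a p xor over j a p

  crossing′ : Path V → Path V → Bool
  crossing′ e f = (under′ e (start f) xor under′ e (finish f)) xor
                  (over′ f (start e) xor over′ f (finish e))

  crossing′-even : ∀ e f →
    crossing (start e) (bend e) (start f) (bend f) ≡ false →
    crossing (start e) (bend e) (finish f) (bend f) ≡ false →
    crossing (finish e) (bend e) (start f) (bend f) ≡ false →
    crossing (finish e) (bend e) (finish f) (bend f) ≡ false →
    crossing′ e f ≡ false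
  crossing′-even (path i j a) (path k l b) p q r s =
    trans
      (bends-cancel
        (under i a k) (under i a b) (under i a l) (under j a k) (under j a b) (under j a l)
        (over k b i) (over k b a) (over k b j) (over l b i) (over l b a) (over l b j))
      (cong₂ _xor_ (cong₂ _xor_ p q) (cong₂ _xor_ r s))

  under′≡over′ : ∀ e p → under′ e p ≡ over′ e p xor (lt (start e) p xor lt (finish e) p)
  under′≡over′ (path i j a) p =
    trans (cong₂ _xor_ (under≡over i a p) (under≡over j a p))
      (bend-cancels (over i a p) (over j a p) (lt i p) (lt j p) (lt a p))

  under-outside : ∀ {a b p} → lt a p ≡ lt b p → under a b p ≡ false
  under-outside {a} {b} {p} e rewrite e | xor-same (lt b p) = refl

  over-outside : ∀ {a b p} → lt a p ≡ lt b p → over a b p ≡ false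
  over-outside {a} {b} {p} e rewrite e | xor-same (lt b p) = refl

  under-between : ∀ {a b p σ} → lt a p ≡ true → lt b p ≡ false → side a b p ≡ σ →
                  under a b p ≡ σ
  under-between p q r rewrite p | q | r = refl

  over-between : ∀ {a b p σ} → lt a p ≡ true → lt b p ≡ false → side a b p ≡ σ →
                 over a b p ≡ not σ
  over-between p q r rewrite p | q | r = refl

  crossing-values : ∀ {a b p q w x y z} → under a b p ≡ w → under a b q ≡ x →
    over p q a ≡ y → over p q b ≡ z → crossing a b p q ≡ (w xor x) xor (y xor z)
  crossing-values w x y z = cong₂ _xor_ (cong₂ _xor_ w x) (cong₂ _xor_ y z)

  crossing-flipʳ : ∀ a b p q → (∀ x → side p q x ≡ side q p x) → crossing a b p q ≡ crossing a b q p
  crossing-flipʳ a b p q s = cong₂ _xor_ (xor-comm (under a b p) (under a b q)) (cong₂ _xor_ (flip a) (flip b))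
    where
    flip : ∀ x → over p q x ≡ over q p x
    flip x = cong₂ _∧_ (xor-comm (lt p x) (lt q x)) (cong not (s x))

  crossing-flipˡ : ∀ a b p q → (∀ x → side a b x ≡ side b a x) → crossing a b p q ≡ crossing b a p q
  crossing-flipˡ a b p q s = cong₂ _xor_ (cong₂ _xor_ (flip p) (flip q)) (xor-comm (over p q a) (over p q b))
    where
    flip : ∀ x → under a b x ≡ under b a x
    flip x = cong₂ _∧_ (xor-comm (lt a x) (lt b x)) (s x)

  -- Trading `under` for `over` costs two comparisons per term. The eight comparisons form four
  -- opposite pairs, each contributing 1, so the total change is even.
  crossing-swap : ∀ a b p q → lt a p xor lt p a ≡ true → lt a q xor lt q a ≡ true →
    lt b p xor lt p b ≡ true → lt b q xor lt q b ≡ true → crossing a b p q ≡ crossing p q a b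
  crossing-swap a b p q ap aq bp bq = trans
    (cong₂ _xor_ (cong₂ _xor_ (under≡over a b p) (under≡over a b q))
      (cong₂ _xor_ (over≡under p q a) (over≡under p q b)))
    (trans
      (swap-roles (over a b p) (over a b q) (under p q a) (under p q b)
        (lt a p) (lt b p) (lt a q) (lt b q) (lt p a) (lt q a) (lt p b) (lt q b))
      (trans (cong (crossing p q a b xor_)
          (cong₂ _xor_ (cong₂ _xor_ ap aq) (cong₂ _xor_ bp bq)))
        (xor-identityʳ (crossing p q a b))))
    where
    over≡under : ∀ a b p → over a b p ≡ under a b p xor (lt a p xor lt b p)
    over≡under a b p with lt a p | lt b p | side a b p
    ... | true  | true  | _     = refl
    ... | true  | false | true  = refl
    ... | true  | false | false = refl
    ... | false | true  | true  = refl
    ... | false | true  | false = refl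
    ... | false | false | _     = refl

open +-*-Solver using (Polynomial; solve; con; _:+_; _:*_; _:-_; :-_; _:=_)

-- Limits of rational sequences

private
  variable
    P Q R : ℕ → Set
    f g : ℕ → ℚ

Eventually : (ℕ → Set) → Set
Eventually P = ∃[ N ] (∀ n → N ℕ.≤ n → P n)

always : (∀ n → P n) → Eventually P
always p = 0 , λ n _ → p n

ev-map : (∀ n → P n → Q n) → Eventually P → Eventually Q
ev-map f (N , p) = N , λ n n≥ → f n (p n n≥)

ev-zip : (∀ n → P n → Q n → R n) → Eventually P → Eventually Q → Eventually R
ev-zip f (M , p) (N , q) = M ℕ.⊔ N , λ n n≥ →
  f n (p n (ℕ.m⊔n≤o⇒m≤o M N n≥)) (q n (ℕ.m⊔n≤o⇒n≤o M N n≥))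

ev-× : Eventually P → Eventually Q → Eventually (λ n → P n × Q n)
ev-× = ev-zip (λ n → _,_)

gap : ∀ {a b} → a ℚ.< b → 0ℚ ℚ.< b ℚ.- a
gap {a} {b} a<b = subst (ℚ._< b ℚ.- a) (ℚ.+-inverseʳ a) (ℚ.+-monoˡ-< (ℚ.- a) a<b)

ungap : ∀ {a b} → 0ℚ ℚ.< b ℚ.- a → a ℚ.< b
ungap {a} {b} h = subst (ℚ._< b) (ℚ.+-identityˡ a)
  (subst (0ℚ ℚ.+ a ℚ.<_) (solve 2 (λ a b → b :- a :+ a := b) refl a b) (ℚ.+-monoˡ-< a h))

half-pos : ∀ {ε} → 0ℚ ℚ.< ε → 0ℚ ℚ.< ½ ℚ.* ε
half-pos {ε} ε>0 = ℚ.positive⁻¹ (½ ℚ.* ε) {{ℚ.pos*pos⇒pos ½ ε {{ℚ.positive ε>0}}}}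

halves : ∀ ε → ½ ℚ.* ε ℚ.+ ½ ℚ.* ε ≡ ε
halves = solve 1 (λ e → con ½ :* e :+ con ½ :* e := e) refl

*-pos : ∀ {p q} → 0ℚ ℚ.< p → 0ℚ ℚ.< q → 0ℚ ℚ.< p ℚ.* q
*-pos {p} {q} p>0 q>0 =
  ℚ.positive⁻¹ (p ℚ.* q) {{ℚ.pos*pos⇒pos p {{ℚ.positive p>0}} q {{ℚ.positive q>0}}}}

*-nonneg : ∀ {p q} → 0ℚ ℚ.≤ p → 0ℚ ℚ.≤ q → 0ℚ ℚ.≤ p ℚ.* q
*-nonneg {p} {q} p≥0 q≥0 = ℚ.nonNegative⁻¹ (p ℚ.* q)
  {{ℚ.nonNeg*nonNeg⇒nonNeg p {{ℚ.nonNegative p≥0}} q {{ℚ.nonNegative q≥0}}}}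

-- Sequences whose limit is at most 0, respectively 0.  Real._≤_ and Real._≈_
-- unfold to these properties of the difference sequence.
Limit≤0 : (ℕ → ℚ) → Set
Limit≤0 f = ∀ ε → 0ℚ ℚ.< ε → Eventually (λ n → f n ℚ.< ε)

Null : (ℕ → ℚ) → Set
Null f = ∀ ε → 0ℚ ℚ.< ε → Eventually (λ n → ∣ f n ∣ ℚ.< ε)

limit≤0-resp : Eventually (λ n → f n ≡ g n) → Limit≤0 f → Limit≤0 g
limit≤0-resp f≡g f≤ ε ε>0 = ev-zip (λ n → subst (ℚ._< ε)) f≡g (f≤ ε ε>0)

limit≤0-+ : Limit≤0 f → Limit≤0 g → Limit≤0 (λ n → f n ℚ.+ g n)
limit≤0-+ {f} {g} f≤ g≤ ε ε>0 =
  ev-zip (λ n p q → subst (f n ℚ.+ g n ℚ.<_) (halves ε) (ℚ.+-mono-< p q))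
    (f≤ (½ ℚ.* ε) (half-pos ε>0)) (g≤ (½ ℚ.* ε) (half-pos ε>0))

limit≤0-nonpos : Eventually (λ n → f n ℚ.≤ 0ℚ) → Limit≤0 f
limit≤0-nonpos f≤0 ε ε>0 = ev-map (λ n p → ℚ.≤-<-trans p ε>0) f≤0

¬limit≤0-const : ∀ {d} → 0ℚ ℚ.< d → ¬ Limit≤0 (const d)
¬limit≤0-const {d} d>0 d≤0 with d≤0 d d>0
... | N , p = ℚ.<-irrefl refl (p N ℕ.≤-refl)

null-resp : Eventually (λ n → f n ≡ g n) → Null f → Null g
null-resp f≡g f≈ ε ε>0 = ev-zip (λ n e → subst (λ x → ∣ x ∣ ℚ.< ε) e) f≡g (f≈ ε ε>0)

null-0 : Eventually (λ n → f n ≡ 0ℚ) → Null f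
null-0 f≡0 ε ε>0 = ev-map (λ n e → subst (λ x → ∣ x ∣ ℚ.< ε) (sym e) ε>0) f≡0

null-neg : Null f → Null (λ n → ℚ.- f n)
null-neg {f} f≈ ε ε>0 = ev-map (λ n → subst (ℚ._< ε) (sym (ℚ.∣-p∣≡∣p∣ (f n)))) (f≈ ε ε>0)

null-+ : Null f → Null g → Null (λ n → f n ℚ.+ g n)
null-+ {f} {g} f≈ g≈ ε ε>0 =
  ev-zip (λ n p q → ℚ.≤-<-trans (ℚ.∣p+q∣≤∣p∣+∣q∣ (f n) (g n))
                      (subst (∣ f n ∣ ℚ.+ ∣ g n ∣ ℚ.<_) (halves ε) (ℚ.+-mono-< p q)))
    (f≈ (½ ℚ.* ε) (half-pos ε>0)) (g≈ (½ ℚ.* ε) (half-pos ε>0))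

p≤∣p∣ : ∀ p → p ℚ.≤ ∣ p ∣
p≤∣p∣ p with ℚ.≤-total 0ℚ p
... | inj₁ p≥0 = ℚ.≤-reflexive (sym (ℚ.0≤p⇒∣p∣≡p p≥0))
... | inj₂ p≤0 = ℚ.≤-trans p≤0 (ℚ.0≤∣p∣ p)

∣∣-< : ∀ {p q} → p ℚ.< q → ℚ.- p ℚ.< q → ∣ p ∣ ℚ.< q
∣∣-< {p} {q} p<q -p<q with ℚ.∣p∣≡p∨∣p∣≡-p p
... | inj₁ e = subst (ℚ._< q) (sym e) p<q
... | inj₂ e = subst (ℚ._< q) (sym e) -p<q

null⇒limit≤0 : Null f → Limit≤0 f
null⇒limit≤0 {f} f≈ ε ε>0 = ev-map (λ n → ℚ.≤-<-trans (p≤∣p∣ (f n))) (f≈ ε ε>0)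

cauchy-bound : IsCauchy f → ∃[ B ] 0ℚ ℚ.< B × Eventually (λ n → ∣ f n ∣ ℚ.< B)
cauchy-bound {f} c with c 1ℚ (ℚ.positive⁻¹ 1ℚ)
... | N , close = ∣ f N ∣ ℚ.+ 1ℚ ,
  ℚ.+-mono-≤-< (ℚ.0≤∣p∣ (f N)) (ℚ.positive⁻¹ 1ℚ) ,
  N , λ n n≥ → begin-strict
    ∣ f n ∣                        ≡⟨ cong ∣_∣ (solve 2 (λ a b → a := b :+ (a :- b)) refl (f n) (f N)) ⟩
    ∣ f N ℚ.+ (f n ℚ.- f N) ∣      ≤⟨ ℚ.∣p+q∣≤∣p∣+∣q∣ (f N) (f n ℚ.- f N) ⟩
    ∣ f N ∣ ℚ.+ ∣ f n ℚ.- f N ∣    <⟨ ℚ.+-monoʳ-< ∣ f N ∣ (close n N n≥ ℕ.≤-refl) ⟩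
    ∣ f N ∣ ℚ.+ 1ℚ                 ∎
  where open ℚ.≤-Reasoning

abstract
  recip : ∀ {q} → 0ℚ ℚ.< q → ∃[ r ] 0ℚ ℚ.< r × q ℚ.* r ≡ 1ℚ
  recip {q} q>0 = r , ℚ.positive⁻¹ r {{ℚ.1/pos⇒pos q {{pos}}}} , ℚ.*-inverseʳ q {{nz}}
    where
    pos : ℚ.Positive q
    pos = ℚ.positive q>0
    nz : ℚ.NonZero q
    nz  = ℚ.pos⇒nonZero q {{pos}}
    r : ℚ
    r   = ℚ.1/_ q {{nz}}

null-* : ∀ x → Null f → Null (λ n → seq x n ℚ.* f n)
null-* {f} x f≈ ε ε>0 =
  let B , B>0 , x<B  = cauchy-bound {seq x} (cauchy x)
      r , r>0 , Br≡1 = recip B>0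
  in ev-zip (λ n → small n B>0 Br≡1) x<B (f≈ (r ℚ.* ε) (*-pos r>0 ε>0))
  where
  open ℚ.≤-Reasoning
  small : ∀ n {B r} → 0ℚ ℚ.< B → B ℚ.* r ≡ 1ℚ →
          ∣ seq x n ∣ ℚ.< B → ∣ f n ∣ ℚ.< r ℚ.* ε → ∣ seq x n ℚ.* f n ∣ ℚ.< ε
  small n {B} {r} B>0 Br≡1 p q = begin-strict
    ∣ seq x n ℚ.* f n ∣        ≡⟨ ℚ.∣p*q∣≡∣p∣*∣q∣ (seq x n) (f n) ⟩
    ∣ seq x n ∣ ℚ.* ∣ f n ∣    ≤⟨ ℚ.*-monoʳ-≤-nonNeg ∣ f n ∣ {{ℚ.∣-∣-nonNeg (f n)}} (ℚ.<⇒≤ p) ⟩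
    B ℚ.* ∣ f n ∣          <⟨ ℚ.*-monoʳ-<-pos B {{ℚ.positive B>0}} q ⟩
    B ℚ.* (r ℚ.* ε)        ≡⟨ sym (ℚ.*-assoc B r ε) ⟩
    B ℚ.* r ℚ.* ε          ≡⟨ cong (ℚ._* ε) Br≡1 ⟩
    1ℚ ℚ.* ε               ≡⟨ ℚ.*-identityˡ ε ⟩
    ε                      ∎

null-cancel : ∀ {d} → d ≢ 0ℚ → Null (λ n → d ℚ.* f n) → Null f
null-cancel {f} {d} d≢0 df≈ =
  null-resp (always λ n → trans (sym (ℚ.*-assoc r d (f n)))
              (trans (cong (ℚ._* f n) (ℚ.*-inverseˡ d)) (ℚ.*-identityˡ (f n))))
    (null-* (fromℚ r) df≈)
  where
  instance
    nz : ℚ.NonZero d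
    nz = ℚ.≢-nonZero d≢0
  r = ℚ.1/ d

-- Strict positivity of the limit. A uniform bound `δ` is required because the terms of a null
-- sequence may all be positive.
Pos : (ℕ → ℚ) → Set
Pos f = ∃[ δ ] 0ℚ ℚ.< δ × Eventually (λ n → δ ℚ.≤ f n)

pos⇒0< : Pos f → Eventually (λ n → 0ℚ ℚ.< f n)
pos⇒0< (δ , δ>0 , e) = ev-map (λ n → ℚ.<-≤-trans δ>0) e

pos-resp : (∀ n → f n ≡ g n) → Pos f → Pos g
pos-resp f≡g (δ , δ>0 , e) = δ , δ>0 , ev-map (λ n → subst (δ ℚ.≤_) (f≡g n)) e

pos-+-nonneg : Pos f → Eventually (λ n → 0ℚ ℚ.≤ g n) → Pos (λ n → f n ℚ.+ g n)
pos-+-nonneg {f} {g} (δ , δ>0 , e) g≥0 = δ , δ>0 , ev-zip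
  (λ n p q → subst (ℚ._≤ f n ℚ.+ g n) (ℚ.+-identityʳ δ) (ℚ.+-mono-≤ p q)) e g≥0

-- Let `N` be the Cauchy bound for half of `ε`. If the term at `N` exceeds that half in absolute
-- value, all later terms stay away from 0 on the same side; if this happens for no `ε`, the
-- sequence is null. No such `ε` can be computed from the hypothesis, hence the double negation.
pos-or-neg : ∀ {f} → IsCauchy f → ¬ Null f → ¬ ¬ (Pos f ⊎ Pos (λ n → ℚ.- f n))
pos-or-neg {f} c f≉0 k = f≉0 small
  where
  small : Null f
  small ε ε>0 with c (½ ℚ.* ε) (half-pos ε>0)
  ... | N , close with ½ ℚ.* ε ℚ.<? f N | ½ ℚ.* ε ℚ.<? ℚ.- f N
  ... | yes p | _ = contradiction (inj₁ (f N ℚ.- ½ ℚ.* ε , gap p , N , λ n n≥ → begin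
      f N ℚ.- ½ ℚ.* ε               ≤⟨ ℚ.+-monoʳ-≤ (f N) (ℚ.neg-antimono-≤ (ℚ.≤-trans (p≤∣p∣ _) (ℚ.<⇒≤ (close N n ℕ.≤-refl n≥)))) ⟩
      f N ℚ.- (f N ℚ.- f n)         ≡⟨ solve 2 (λ a b → a :- (a :- b) := b) refl (f N) (f n) ⟩
      f n                           ∎)) k
    where open ℚ.≤-Reasoning
  ... | no _ | yes p = contradiction (inj₂ (ℚ.- f N ℚ.- ½ ℚ.* ε , gap p , N , λ n n≥ → begin
      ℚ.- f N ℚ.- ½ ℚ.* ε           ≤⟨ ℚ.+-monoʳ-≤ (ℚ.- f N) (ℚ.neg-antimono-≤ (ℚ.≤-trans (p≤∣p∣ _) (ℚ.<⇒≤ (close n N n≥ ℕ.≤-refl)))) ⟩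
      ℚ.- f N ℚ.- (f n ℚ.- f N)     ≡⟨ solve 2 (λ a b → (:- a) :- (b :- a) := :- b) refl (f N) (f n) ⟩
      ℚ.- f n                       ∎)) k
    where open ℚ.≤-Reasoning
  ... | no p | no q = N , λ n n≥ → begin-strict
      ∣ f n ∣                        ≡⟨ cong ∣_∣ (solve 2 (λ a b → a := b :+ (a :- b)) refl (f n) (f N)) ⟩
      ∣ f N ℚ.+ (f n ℚ.- f N) ∣      ≤⟨ ℚ.∣p+q∣≤∣p∣+∣q∣ (f N) (f n ℚ.- f N) ⟩
      ∣ f N ∣ ℚ.+ ∣ f n ℚ.- f N ∣    <⟨ ℚ.+-mono-≤-< fN≤ (close n N n≥ ℕ.≤-refl) ⟩
      ½ ℚ.* ε ℚ.+ ½ ℚ.* ε            ≡⟨ halves ε ⟩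
      ε                              ∎
    where
    open ℚ.≤-Reasoning
    fN≤ : ∣ f N ∣ ℚ.≤ ½ ℚ.* ε
    fN≤ with ℚ.∣p∣≡p∨∣p∣≡-p (f N)
    ... | inj₁ e = subst (ℚ._≤ ½ ℚ.* ε) (sym e) (ℚ.≮⇒≥ p)
    ... | inj₂ e = subst (ℚ._≤ ½ ℚ.* ε) (sym e) (ℚ.≮⇒≥ q)

recip-cauchy : IsCauchy f → ∀ {δ} (δ>0 : 0ℚ ℚ.< δ) (f≥δ : ∀ n → δ ℚ.≤ f n) →
               IsCauchy (λ n → proj₁ (recip (ℚ.<-≤-trans δ>0 (f≥δ n))))
-- The difference of reciprocals is `r m * r n * (f n - f m)`, and each reciprocal is at most
-- `1 / δ`; hence the tolerance `δ * δ * ε`.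
recip-cauchy {f} c {δ} δ>0 f≥δ ε ε>0 with c (δ ℚ.* δ ℚ.* ε) (*-pos (*-pos δ>0 δ>0) ε>0)
... | N , close = N , λ m n m≥ n≥ → ∣∣-< (below m n (close n m n≥ m≥))
    (subst (ℚ._< ε) (solve 2 (λ a b → a :- b := :- (b :- a)) refl (r n) (r m))
      (below n m (close m n m≥ n≥)))
  where
  open ℚ.≤-Reasoning
  f>0 : ∀ n → 0ℚ ℚ.< f n
  f>0 n = ℚ.<-≤-trans δ>0 (f≥δ n)
  r : ℕ → ℚ
  r n = proj₁ (recip (f>0 n))
  r>0 : ∀ n → 0ℚ ℚ.< r n
  r>0 n = proj₁ (proj₂ (recip (f>0 n)))
  fr≡1 : ∀ n → f n ℚ.* r n ≡ 1ℚ
  fr≡1 n = proj₂ (proj₂ (recip (f>0 n)))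

  δr≤1 : ∀ n → δ ℚ.* r n ℚ.≤ 1ℚ
  δr≤1 n = subst (δ ℚ.* r n ℚ.≤_) (fr≡1 n)
    (ℚ.*-monoʳ-≤-nonNeg (r n) {{ℚ.nonNegative (ℚ.<⇒≤ (r>0 n))}} (f≥δ n))

  below : ∀ m n → ∣ f n ℚ.- f m ∣ ℚ.< δ ℚ.* δ ℚ.* ε → r m ℚ.- r n ℚ.< ε
  below m n cl = begin-strict
    r m ℚ.- r n
      ≡⟨ cong₂ ℚ._-_ (trans (sym (ℚ.*-identityʳ (r m))) (cong (r m ℚ.*_) (sym (fr≡1 n))))
                     (trans (sym (ℚ.*-identityʳ (r n))) (cong (r n ℚ.*_) (sym (fr≡1 m)))) ⟩
    r m ℚ.* (f n ℚ.* r n) ℚ.- r n ℚ.* (f m ℚ.* r m)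
      ≡⟨ solve 4 (λ a b c d → a :* (c :* b) :- b :* (d :* a) := a :* b :* (c :- d)) refl (r m) (r n) (f n) (f m) ⟩
    r m ℚ.* r n ℚ.* (f n ℚ.- f m)
      <⟨ ℚ.*-monoʳ-<-pos (r m ℚ.* r n) {{ℚ.positive (*-pos (r>0 m) (r>0 n))}} (ℚ.≤-<-trans (p≤∣p∣ _) cl) ⟩
    r m ℚ.* r n ℚ.* (δ ℚ.* δ ℚ.* ε)
      ≡⟨ solve 4 (λ a b d e → a :* b :* (d :* d :* e) := (d :* a) :* ((d :* b) :* e)) refl (r m) (r n) δ ε ⟩
    (δ ℚ.* r m) ℚ.* ((δ ℚ.* r n) ℚ.* ε)
      ≤⟨ ℚ.*-monoʳ-≤-nonNeg _ {{ℚ.nonNegative (*-nonneg (*-nonneg (ℚ.<⇒≤ δ>0) (ℚ.<⇒≤ (r>0 n))) (ℚ.<⇒≤ ε>0))}} (δr≤1 m) ⟩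
    1ℚ ℚ.* ((δ ℚ.* r n) ℚ.* ε)
      ≡⟨ ℚ.*-identityˡ _ ⟩
    (δ ℚ.* r n) ℚ.* ε
      ≤⟨ ℚ.*-monoʳ-≤-nonNeg ε {{ℚ.nonNegative (ℚ.<⇒≤ ε>0)}} (δr≤1 n) ⟩
    1ℚ ℚ.* ε
      ≡⟨ ℚ.*-identityˡ ε ⟩
    ε ∎

abstract
  -- Freezing the first N terms makes the lower bound hold at every index.
  reciprocal : ∀ x → Pos (seq x) →
               ∃[ r ] Eventually (λ n → 0ℚ ℚ.≤ seq r n × seq r n ℚ.* seq x n ≡ 1ℚ)
  reciprocal x (δ , δ>0 , N , x≥δ) =
    mkℝ r (recip-cauchy {y} y-cauchy δ>0 y≥δ) , N , λ n n≥ →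
      ℚ.<⇒≤ (proj₁ (proj₂ (recip (y>0 n)))) ,
      trans (cong (λ m → r n ℚ.* seq x m) (sym (ℕ.m≥n⇒m⊔n≡m n≥)))
        (trans (ℚ.*-comm (r n) (y n)) (proj₂ (proj₂ (recip (y>0 n)))))
    where
    y : ℕ → ℚ
    y n = seq x (n ℕ.⊔ N)
    y≥δ : ∀ n → δ ℚ.≤ y n
    y≥δ n = x≥δ (n ℕ.⊔ N) (ℕ.m≤n⊔m n N)
    y>0 : ∀ n → 0ℚ ℚ.< y n
    y>0 n = ℚ.<-≤-trans δ>0 (y≥δ n)
    r : ℕ → ℚ
    r n = proj₁ (recip (y>0 n))
    y-cauchy : IsCauchy y
    y-cauchy ε ε>0 with cauchy x ε ε>0
    ... | M , close = M , λ m n m≥ n≥ →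
      close (m ℕ.⊔ N) (n ℕ.⊔ N) (ℕ.≤-trans m≥ (ℕ.m≤m⊔n m N)) (ℕ.≤-trans n≥ (ℕ.m≤m⊔n n N))

-- Crossing segments

det : (ax ay bx by px py : ℚ) → ℚ
det ax ay bx by px py = (bx ℚ.- ax) ℚ.* (py ℚ.- ay) ℚ.- (by ℚ.- ay) ℚ.* (px ℚ.- ax)

private
  :det : ∀ {n} (ax ay bx by px py : Polynomial n) → Polynomial n
  :det ax ay bx by px py = (bx :- ax) :* (py :- ay) :- (by :- ay) :* (px :- ax)

-- Cramer's rule without division. With `A = det a b p`, `B = det a b q`, `C = det q p a` and
-- `Δ = A - B`, the point at `A / Δ` along `pq` is the point at `C / Δ` along `ab`.
cramer-x : ∀ ax ay bx by px py qx qy →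
  det ax ay bx by px py ℚ.* (qx ℚ.- px) ℚ.+ det qx qy px py ax ay ℚ.* (ax ℚ.- bx) ≡
  (det ax ay bx by px py ℚ.- det ax ay bx by qx qy) ℚ.* (ax ℚ.- px)
cramer-x = solve 8 (λ ax ay bx by px py qx qy →
  :det ax ay bx by px py :* (qx :- px) :+ :det qx qy px py ax ay :* (ax :- bx) :=
  (:det ax ay bx by px py :- :det ax ay bx by qx qy) :* (ax :- px)) refl

cramer-y : ∀ ax ay bx by px py qx qy →
  det ax ay bx by px py ℚ.* (qy ℚ.- py) ℚ.+ det qx qy px py ax ay ℚ.* (ay ℚ.- by) ≡
  (det ax ay bx by px py ℚ.- det ax ay bx by qx qy) ℚ.* (ay ℚ.- py)
cramer-y = solve 8 (λ ax ay bx by px py qx qy →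
  :det ax ay bx by px py :* (qy :- py) :+ :det qx qy px py ax ay :* (ay :- by) :=
  (:det ax ay bx by px py :- :det ax ay bx by qx qy) :* (ay :- py)) refl

-- Writes the denominator `A - B` as `D + C` with `D = det p q b`, so that the parameter `C / Δ` on
-- `ab` has complement `D / Δ`.
det-difference : ∀ ax ay bx by px py qx qy →
  det ax ay bx by px py ℚ.- det ax ay bx by qx qy ≡
  det px py qx qy bx by ℚ.+ det qx qy px py ax ay
det-difference = solve 8 (λ ax ay bx by px py qx qy →
  :det ax ay bx by px py :- :det ax ay bx by qx qy :=
  :det px py qx qy bx by :+ :det qx qy px py ax ay) refl

det-flip : ∀ ax ay bx by px py → det bx by ax ay px py ≡ ℚ.- det ax ay bx by px py
det-flip = solve 6 (λ ax ay bx by px py →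
  :det bx by ax ay px py := :- :det ax ay bx by px py) refl

-- Together with `shear-y`: the deviation of `p` from the point of the line `ab` at the same level,
-- scaled by the level difference of `a` and `b`, is the determinant times `(-t , 1)`, a direction
-- along which the level is constant.
shear-x : ∀ t ax ay bx by px py →
  ((bx ℚ.+ t ℚ.* by) ℚ.- (ax ℚ.+ t ℚ.* ay)) ℚ.* (px ℚ.- ax) ℚ.-
  ((px ℚ.+ t ℚ.* py) ℚ.- (ax ℚ.+ t ℚ.* ay)) ℚ.* (bx ℚ.- ax) ≡
  (ℚ.- t) ℚ.* det ax ay bx by px py
shear-x = solve 7 (λ t ax ay bx by px py →
  ((bx :+ t :* by) :- (ax :+ t :* ay)) :* (px :- ax) :-
  ((px :+ t :* py) :- (ax :+ t :* ay)) :* (bx :- ax) :=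
  (:- t) :* :det ax ay bx by px py) refl

shear-y : ∀ t ax ay bx by px py →
  ((bx ℚ.+ t ℚ.* by) ℚ.- (ax ℚ.+ t ℚ.* ay)) ℚ.* (py ℚ.- ay) ℚ.-
  ((px ℚ.+ t ℚ.* py) ℚ.- (ax ℚ.+ t ℚ.* ay)) ℚ.* (by ℚ.- ay) ≡
  det ax ay bx by px py
shear-y = solve 7 (λ t ax ay bx by px py →
  ((bx :+ t :* by) :- (ax :+ t :* ay)) :* (py :- ay) :-
  ((px :+ t :* py) :- (ax :+ t :* ay)) :* (by :- ay) :=
  :det ax ay bx by px py) refl

-- The height of q over the line ab, by linear interpolation between p and q.
interpolate : ∀ t ax ay bx by px py qx qy → let l = λ x y → x ℚ.+ t ℚ.* y in
  (ℚ.- det ax ay bx by qx qy) ℚ.* (l bx by ℚ.- l px py) ≡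
  det px py qx qy bx by ℚ.* (l bx by ℚ.- l ax ay) ℚ.+
  det ax ay bx by px py ℚ.* (l qx qy ℚ.- l bx by)
interpolate = solve 9 (λ t ax ay bx by px py qx qy → let l = λ x y → x :+ t :* y in
  (:- :det ax ay bx by qx qy) :* (l bx by :- l px py) :=
  :det px py qx qy bx by :* (l bx by :- l ax ay) :+
  :det ax ay bx by px py :* (l qx qy :- l bx by)) refl

cancel-pos : ∀ {z w} → 0ℚ ℚ.< w → 0ℚ ℚ.< z ℚ.* w → 0ℚ ℚ.< z
cancel-pos {z} {w} w>0 zw>0 = ℚ.*-cancelʳ-<-nonNeg w {{ℚ.nonNegative (ℚ.<⇒≤ w>0)}}
  (subst (ℚ._< z ℚ.* w) (sym (ℚ.*-zeroˡ w)) zw>0)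

+-pos : ∀ {p q} → 0ℚ ℚ.< p → 0ℚ ℚ.< q → 0ℚ ℚ.< p ℚ.+ q
+-pos = ℚ.+-mono-<

neg-pos⇒nonpos : ∀ {p} → 0ℚ ℚ.< ℚ.- p → p ℚ.≤ 0ℚ
neg-pos⇒nonpos {p} h = ℚ.<⇒≤ (subst (ℚ._< 0ℚ) (solve 1 (λ p → :- (:- p) := p) refl p) (ℚ.neg-antimono-< h))

-- The lower-case letters are levels; the capitals are the orientations of `p` and `q` against `ab`,
-- of `a` against `qp`, and of `b` against `pq`. Both identities are homogeneous in the capitals, so
-- they may all be multiplied by a common sign.
module _ {A B C D a b p q : ℚ}
  (interp : (ℚ.- B) ℚ.* (b ℚ.- p) ≡ D ℚ.* (b ℚ.- a) ℚ.+ A ℚ.* (q ℚ.- b))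
  (diff : A ℚ.- B ≡ D ℚ.+ C) where

  private
    C≡ : C ≡ (A ℚ.- B) ℚ.- D
    C≡ = trans (solve 2 (λ c d → c := (d :+ c) :- d) refl C D) (cong (ℚ._- D) (sym diff))

  overlapping-signs : a ℚ.< p → p ℚ.< b → b ℚ.< q → 0ℚ ℚ.< A → 0ℚ ℚ.< D →
                      B ℚ.≤ 0ℚ × 0ℚ ℚ.≤ C
  overlapping-signs a<p p<b b<q A>0 D>0 =
    neg-pos⇒nonpos (cancel-pos (gap p<b) (subst (0ℚ ℚ.<_) (sym interp)
      (+-pos (*-pos D>0 (gap (ℚ.<-trans a<p p<b))) (*-pos A>0 (gap b<q))))) ,
    ℚ.<⇒≤ (cancel-pos (gap p<b) (subst (0ℚ ℚ.<_) (sym C*)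
      (+-pos (*-pos A>0 (gap (ℚ.<-trans p<b b<q))) (*-pos D>0 (gap a<p)))))
    where
    open ℚ.≤-Reasoning
    C* : C ℚ.* (b ℚ.- p) ≡ A ℚ.* (q ℚ.- p) ℚ.+ D ℚ.* (p ℚ.- a)
    C* = begin-equality
      C ℚ.* (b ℚ.- p)
        ≡⟨ cong (λ c → c ℚ.* (b ℚ.- p)) C≡ ⟩
      ((A ℚ.- B) ℚ.- D) ℚ.* (b ℚ.- p)
        ≡⟨ solve 5 (λ A B D b p → ((A :- B) :- D) :* (b :- p) := (:- B) :* (b :- p) :+ (A :- D) :* (b :- p)) refl A B D b p ⟩
      (ℚ.- B) ℚ.* (b ℚ.- p) ℚ.+ (A ℚ.- D) ℚ.* (b ℚ.- p)
        ≡⟨ cong (ℚ._+ (A ℚ.- D) ℚ.* (b ℚ.- p)) interp ⟩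
      D ℚ.* (b ℚ.- a) ℚ.+ A ℚ.* (q ℚ.- b) ℚ.+ (A ℚ.- D) ℚ.* (b ℚ.- p)
        ≡⟨ solve 6 (λ A D a b p q → D :* (b :- a) :+ A :* (q :- b) :+ (A :- D) :* (b :- p) := A :* (q :- p) :+ D :* (p :- a)) refl A D a b p q ⟩
      A ℚ.* (q ℚ.- p) ℚ.+ D ℚ.* (p ℚ.- a) ∎

  nested-signs : a ℚ.< p → p ℚ.< q → q ℚ.< b → 0ℚ ℚ.< A → 0ℚ ℚ.< ℚ.- B →
                 0ℚ ℚ.≤ C × 0ℚ ℚ.≤ D
  nested-signs a<p p<q q<b A>0 −B>0 =
    ℚ.<⇒≤ (cancel-pos (gap a<b) (subst (0ℚ ℚ.<_) (sym C*)
      (+-pos (*-pos A>0 (gap (ℚ.<-trans a<p p<q))) (*-pos −B>0 (gap a<p))))) ,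
    ℚ.<⇒≤ (cancel-pos (gap a<b) (subst (0ℚ ℚ.<_) (sym D*)
      (+-pos (*-pos A>0 (gap q<b)) (*-pos −B>0 (gap (ℚ.<-trans p<q q<b))))))
    where
    open ℚ.≤-Reasoning
    a<b : a ℚ.< b
    a<b = ℚ.<-trans a<p (ℚ.<-trans p<q q<b)

    D* : D ℚ.* (b ℚ.- a) ≡ A ℚ.* (b ℚ.- q) ℚ.+ (ℚ.- B) ℚ.* (b ℚ.- p)
    D* = begin-equality
      D ℚ.* (b ℚ.- a)
        ≡⟨ solve 5 (λ A D a b q → D :* (b :- a) := A :* (b :- q) :+ (D :* (b :- a) :+ A :* (q :- b))) refl A D a b q ⟩
      A ℚ.* (b ℚ.- q) ℚ.+ (D ℚ.* (b ℚ.- a) ℚ.+ A ℚ.* (q ℚ.- b))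
        ≡⟨ cong (A ℚ.* (b ℚ.- q) ℚ.+_) (sym interp) ⟩
      A ℚ.* (b ℚ.- q) ℚ.+ (ℚ.- B) ℚ.* (b ℚ.- p) ∎

    C* : C ℚ.* (b ℚ.- a) ≡ A ℚ.* (q ℚ.- a) ℚ.+ (ℚ.- B) ℚ.* (p ℚ.- a)
    C* = begin-equality
      C ℚ.* (b ℚ.- a)
        ≡⟨ cong (λ c → c ℚ.* (b ℚ.- a)) C≡ ⟩
      ((A ℚ.- B) ℚ.- D) ℚ.* (b ℚ.- a)
        ≡⟨ solve 5 (λ A B D a b → ((A :- B) :- D) :* (b :- a) := (A :- B) :* (b :- a) :- D :* (b :- a)) refl A B D a b ⟩
      (A ℚ.- B) ℚ.* (b ℚ.- a) ℚ.- D ℚ.* (b ℚ.- a)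
        ≡⟨ cong (λ x → (A ℚ.- B) ℚ.* (b ℚ.- a) ℚ.- x) D* ⟩
      (A ℚ.- B) ℚ.* (b ℚ.- a) ℚ.- (A ℚ.* (b ℚ.- q) ℚ.+ (ℚ.- B) ℚ.* (b ℚ.- p))
        ≡⟨ solve 6 (λ A B a b p q → (A :- B) :* (b :- a) :- (A :* (b :- q) :+ (:- B) :* (b :- p)) := A :* (q :- a) :+ (:- B) :* (p :- a)) refl A B a b p q ⟩
      A ℚ.* (q ℚ.- a) ℚ.+ (ℚ.- B) ℚ.* (p ℚ.- a) ∎

-- Segments with real end points

orient : Point → Point → Point → ℝ
orient (ax , ay) (bx , by) (px , py) =
  (bx Real.- ax) Real.* (py Real.- ay) Real.- (by Real.- ay) Real.* (px Real.- ax)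

-- The first coordinate after a shear; a generic t separates any finite set of points.
level : ℚ → Point → ℝ
level t (x , y) = x Real.+ fromℚ t Real.* y

segment-flip : ∀ a b z → OnSegment a b z → OnSegment b a z
segment-flip (ax , ay) (bx , by) (x , y) (t , t≥0 , t≤1 , zx , zy) =
  Real.1ℝ Real.- t ,
  limit≤0-resp (always λ n → solve 1 (λ t → t :- con 1ℚ := con 0ℚ :- (con 1ℚ :- t)) refl (seq t n)) t≤1 ,
  limit≤0-resp (always λ n → solve 1 (λ t → con 0ℚ :- t := (con 1ℚ :- t) :- con 1ℚ) refl (seq t n)) t≥0 ,
  null-resp (always λ n → flip (seq x n) (seq t n) (seq ax n) (seq bx n)) zx ,
  null-resp (always λ n → flip (seq y n) (seq t n) (seq ay n) (seq by n)) zy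
  where
  flip : ∀ z t a b → z ℚ.- ((1ℚ ℚ.- t) ℚ.* a ℚ.+ t ℚ.* b) ≡
                     z ℚ.- ((1ℚ ℚ.- (1ℚ ℚ.- t)) ℚ.* b ℚ.+ (1ℚ ℚ.- t) ℚ.* a)
  flip = solve 4 (λ z t a b → z :- ((con 1ℚ :- t) :* a :+ t :* b) :=
    z :- ((con 1ℚ :- (con 1ℚ :- t)) :* b :+ (con 1ℚ :- t) :* a)) refl

start-on-segment : ∀ a b → OnSegment a b a
start-on-segment (ax , ay) (bx , by) =
  Real.0ℝ , limit≤0-nonpos (always λ _ → ℚ.≤-refl) ,
  limit≤0-nonpos (always λ _ → ℚ.<⇒≤ (ℚ.negative⁻¹ _)) ,
  null-0 (always λ n → at-0 (seq ax n) (seq bx n)) , null-0 (always λ n → at-0 (seq ay n) (seq by n))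
  where
  at-0 : ∀ a b → a ℚ.- ((1ℚ ℚ.- 0ℚ) ℚ.* a ℚ.+ 0ℚ ℚ.* b) ≡ 0ℚ
  at-0 = solve 2 (λ a b → a :- ((con 1ℚ :- con 0ℚ) :* a :+ con 0ℚ :* b) := con 0ℚ) refl

end-on-segment : ∀ a b → OnSegment a b b
end-on-segment a b = segment-flip b a b (start-on-segment b a)

on-segment : ∀ a b z t →
  Eventually (λ n → 0ℚ ℚ.≤ seq t n × 0ℚ ℚ.≤ 1ℚ ℚ.- seq t n) →
  z ≈ₚ ((Real.1ℝ Real.- t) Real.* proj₁ a Real.+ t Real.* proj₁ b , (Real.1ℝ Real.- t) Real.* proj₂ a Real.+ t Real.* proj₂ b) →
  OnSegment a b z
on-segment a b z t bounds z≈ =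
  t ,
  limit≤0-nonpos (ev-map (λ n (t≥0 , _) → subst (ℚ._≤ 0ℚ) (sym (ℚ.+-identityˡ (ℚ.- seq t n))) (ℚ.neg-antimono-≤ t≥0)) bounds) ,
  limit≤0-nonpos (ev-map (λ n (_ , t≤1) → subst (ℚ._≤ 0ℚ) (solve 1 (λ t → :- (con 1ℚ :- t) := t :- con 1ℚ) refl (seq t n)) (ℚ.neg-antimono-≤ t≤1)) bounds) ,
  z≈

private
  meet : ∀ A B C a b p q s r → A ℚ.* (q ℚ.- p) ℚ.+ C ℚ.* (a ℚ.- b) ≡ (A ℚ.- B) ℚ.* (a ℚ.- p) →
         r ℚ.* (s ℚ.* (A ℚ.- B)) ≡ 1ℚ →
         let t = s ℚ.* A ℚ.* r ; u = s ℚ.* C ℚ.* r in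
         ((1ℚ ℚ.- t) ℚ.* p ℚ.+ t ℚ.* q) ℚ.- ((1ℚ ℚ.- u) ℚ.* a ℚ.+ u ℚ.* b) ≡ 0ℚ
  meet A B C a b p q s r cramer rΔ≡1 = begin-equality
    ((1ℚ ℚ.- t) ℚ.* p ℚ.+ t ℚ.* q) ℚ.- ((1ℚ ℚ.- u) ℚ.* a ℚ.+ u ℚ.* b)
      ≡⟨ solve 8 (λ A C a b p q s r → let t = s :* A :* r ; u = s :* C :* r in
           ((con 1ℚ :- t) :* p :+ t :* q) :- ((con 1ℚ :- u) :* a :+ u :* b) :=
           (p :- a) :+ r :* (s :* (A :* (q :- p) :+ C :* (a :- b)))) refl A C a b p q s r ⟩
    (p ℚ.- a) ℚ.+ r ℚ.* (s ℚ.* (A ℚ.* (q ℚ.- p) ℚ.+ C ℚ.* (a ℚ.- b)))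
      ≡⟨ cong (λ x → (p ℚ.- a) ℚ.+ r ℚ.* (s ℚ.* x)) cramer ⟩
    (p ℚ.- a) ℚ.+ r ℚ.* (s ℚ.* ((A ℚ.- B) ℚ.* (a ℚ.- p)))
      ≡⟨ solve 5 (λ r s Δ a p → (p :- a) :+ r :* (s :* (Δ :* (a :- p))) :=
           (con 1ℚ :- r :* (s :* Δ)) :* (p :- a)) refl r s (A ℚ.- B) a p ⟩
    (1ℚ ℚ.- r ℚ.* (s ℚ.* (A ℚ.- B))) ℚ.* (p ℚ.- a)
      ≡⟨ cong (λ x → (1ℚ ℚ.- x) ℚ.* (p ℚ.- a)) rΔ≡1 ⟩
    (1ℚ ℚ.- 1ℚ) ℚ.* (p ℚ.- a)
      ≡⟨ ℚ.*-zeroˡ (p ℚ.- a) ⟩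
    0ℚ ∎
    where
    open ℚ.≤-Reasoning
    t u : ℚ
    t = s ℚ.* A ℚ.* r
    u = s ℚ.* C ℚ.* r

  complement : ∀ A B s r → r ℚ.* (s ℚ.* (A ℚ.- B)) ≡ 1ℚ →
               1ℚ ℚ.- s ℚ.* A ℚ.* r ≡ (ℚ.- (s ℚ.* B)) ℚ.* r
  complement A B s r rΔ≡1 =
    trans (cong (ℚ._- s ℚ.* A ℚ.* r) (sym rΔ≡1))
      (solve 4 (λ A B s r → r :* (s :* (A :- B)) :- s :* A :* r := (:- (s :* B)) :* r) refl A B s r)

  nonpos⇒neg-nonneg : ∀ {p} → p ℚ.≤ 0ℚ → 0ℚ ℚ.≤ ℚ.- p
  nonpos⇒neg-nonneg = ℚ.neg-antimono-≤

  scaled-difference : ∀ s A B → s ℚ.* A ℚ.+ (ℚ.- (s ℚ.* B)) ≡ s ℚ.* (A ℚ.- B)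
  scaled-difference = solve 3 (λ s A B → s :* A :+ (:- (s :* B)) := s :* (A :- B)) refl

  complement′ : ∀ C D s r → r ℚ.* (s ℚ.* (D ℚ.+ C)) ≡ 1ℚ →
                1ℚ ℚ.- s ℚ.* C ℚ.* r ≡ s ℚ.* D ℚ.* r
  complement′ C D s r rΔ≡1 =
    trans (cong (ℚ._- s ℚ.* C ℚ.* r) (sym rΔ≡1))
      (solve 4 (λ C D s r → r :* (s :* (D :+ C)) :- s :* C :* r := s :* D :* r) refl C D s r)

  module Meet (a b p q : Point) (A B C D : ℝ) (s : ℚ)
    (cramerˣ : ∀ n → seq A n ℚ.* (seq (proj₁ q) n ℚ.- seq (proj₁ p) n) ℚ.+
                     seq C n ℚ.* (seq (proj₁ a) n ℚ.- seq (proj₁ b) n) ≡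
                     (seq A n ℚ.- seq B n) ℚ.* (seq (proj₁ a) n ℚ.- seq (proj₁ p) n))
    (cramerʸ : ∀ n → seq A n ℚ.* (seq (proj₂ q) n ℚ.- seq (proj₂ p) n) ℚ.+
                     seq C n ℚ.* (seq (proj₂ a) n ℚ.- seq (proj₂ b) n) ≡
                     (seq A n ℚ.- seq B n) ℚ.* (seq (proj₂ a) n ℚ.- seq (proj₂ p) n))
    (differ : ∀ n → seq A n ℚ.- seq B n ≡ seq D n ℚ.+ seq C n)
    (A>0 : Pos (λ n → s ℚ.* seq A n))
    (r : ℝ) (r-inverse : Eventually (λ n → 0ℚ ℚ.≤ seq r n ×
                           seq r n ℚ.* (s ℚ.* (seq A n ℚ.- seq B n)) ≡ 1ℚ))
    (B≤0 : Eventually (λ n → s ℚ.* seq B n ℚ.≤ 0ℚ))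
    (C≥0 : Eventually (λ n → 0ℚ ℚ.≤ s ℚ.* seq C n))
    (D≥0 : Eventually (λ n → 0ℚ ℚ.≤ s ℚ.* seq D n))
    where

    -- These are `A / Δ` and `C / Δ` from Cramer's rule: `r` inverts `s * Δ`, so the sign `s`
    -- cancels.
    t u : ℝ
    t = fromℚ s Real.* A Real.* r
    u = fromℚ s Real.* C Real.* r

    z : Point
    z = (Real.1ℝ Real.- t) Real.* proj₁ p Real.+ t Real.* proj₁ q , (Real.1ℝ Real.- t) Real.* proj₂ p Real.+ t Real.* proj₂ q

    t-bounds : Eventually (λ n → 0ℚ ℚ.≤ seq t n × 0ℚ ℚ.≤ 1ℚ ℚ.- seq t n)
    t-bounds = ev-zip
      (λ n (r≥0 , rΔ≡1) (A>0 , B≤0) →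
        *-nonneg (ℚ.<⇒≤ A>0) r≥0 ,
        subst (0ℚ ℚ.≤_) (sym (complement (seq A n) (seq B n) s (seq r n) rΔ≡1))
          (*-nonneg (nonpos⇒neg-nonneg B≤0) r≥0))
      r-inverse (ev-× (pos⇒0< A>0) B≤0)

    u-bounds : Eventually (λ n → 0ℚ ℚ.≤ seq u n × 0ℚ ℚ.≤ 1ℚ ℚ.- seq u n)
    u-bounds = ev-zip
      (λ n (r≥0 , rΔ≡1) (C≥0 , D≥0) →
        *-nonneg C≥0 r≥0 ,
        subst (0ℚ ℚ.≤_)
          (sym (complement′ (seq C n) (seq D n) s (seq r n)
            (subst (λ d → seq r n ℚ.* (s ℚ.* d) ≡ 1ℚ) (differ n) rΔ≡1)))
          (*-nonneg D≥0 r≥0))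
      r-inverse (ev-× C≥0 D≥0)

    z-on-ab : OnSegment a b z
    z-on-ab = on-segment a b z u u-bounds
      ( null-0 (ev-map (λ n (_ , rΔ≡1) → meet (seq A n) (seq B n) (seq C n)
          (seq (proj₁ a) n) (seq (proj₁ b) n) (seq (proj₁ p) n) (seq (proj₁ q) n)
          s (seq r n) (cramerˣ n) rΔ≡1) r-inverse)
      , null-0 (ev-map (λ n (_ , rΔ≡1) → meet (seq A n) (seq B n) (seq C n)
          (seq (proj₂ a) n) (seq (proj₂ b) n) (seq (proj₂ p) n) (seq (proj₂ q) n)
          s (seq r n) (cramerʸ n) rΔ≡1) r-inverse))

    z-on-pq : OnSegment p q z
    z-on-pq = on-segment p q z t t-bounds
      ( null-0 (always λ n → ℚ.+-inverseʳ (seq (proj₁ z) n))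
      , null-0 (always λ n → ℚ.+-inverseʳ (seq (proj₂ z) n)))

-- The sign `s` covers both orientations at once. The first hypothesis is strict so that, with the
-- second, the denominator `A - B` is invertible; the weak inequalities then put both parameters
-- between 0 and 1.
segments-meet : ∀ a b p q s →
  Pos (λ n → s ℚ.* seq (orient a b p) n) →
  Eventually (λ n → s ℚ.* seq (orient a b q) n ℚ.≤ 0ℚ) →
  Eventually (λ n → 0ℚ ℚ.≤ s ℚ.* seq (orient q p a) n) →
  Eventually (λ n → 0ℚ ℚ.≤ s ℚ.* seq (orient p q b) n) →
  ∃[ z ] OnSegment a b z × OnSegment p q z
segments-meet a@(ax , ay) b@(bx , by) p@(px , py) q@(qx , qy) s A>0 B≤0 C≥0 D≥0 =
  M.z , M.z-on-ab , M.z-on-pq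
  where
  Δ>0 : Pos (λ n → s ℚ.* (seq (orient a b p) n ℚ.- seq (orient a b q) n))
  Δ>0 = pos-resp (λ n → scaled-difference s (seq (orient a b p) n) (seq (orient a b q) n))
    (pos-+-nonneg A>0 (ev-map (λ n → nonpos⇒neg-nonneg) B≤0))

  Δ⁻¹ : ∃[ r ] Eventually (λ n → 0ℚ ℚ.≤ seq r n × seq r n ℚ.* (s ℚ.* (seq (orient a b p) n ℚ.- seq (orient a b q) n)) ≡ 1ℚ)
  Δ⁻¹ = reciprocal (fromℚ s Real.* (orient a b p Real.- orient a b q)) Δ>0

  module M = Meet a b p q (orient a b p) (orient a b q) (orient q p a) (orient p q b) s
    (λ n → cramer-x (seq ax n) (seq ay n) (seq bx n) (seq by n) (seq px n) (seq py n) (seq qx n) (seq qy n))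
    (λ n → cramer-y (seq ax n) (seq ay n) (seq bx n) (seq by n) (seq px n) (seq py n) (seq qx n) (seq qy n))
    (λ n → det-difference (seq ax n) (seq ay n) (seq bx n) (seq by n) (seq px n) (seq py n) (seq qx n) (seq qy n))
    A>0 (proj₁ Δ⁻¹) (proj₂ Δ⁻¹) B≤0 C≥0 D≥0

private
  rest : ∀ a b p r → r ℚ.* (b ℚ.- a) ≡ 1ℚ → 1ℚ ℚ.- (p ℚ.- a) ℚ.* r ≡ (b ℚ.- p) ℚ.* r
  rest a b p r rl≡1 = trans (cong (ℚ._- (p ℚ.- a) ℚ.* r) (sym rl≡1))
    (solve 4 (λ a b p r → r :* (b :- a) :- (p :- a) :* r := (b :- p) :* r) refl a b p r)

  defect : ∀ x y z a b p r → r ℚ.* (b ℚ.- a) ≡ 1ℚ → let u = (p ℚ.- a) ℚ.* r in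
    r ℚ.* ((b ℚ.- a) ℚ.* (z ℚ.- x) ℚ.- (p ℚ.- a) ℚ.* (y ℚ.- x)) ≡
    z ℚ.- ((1ℚ ℚ.- u) ℚ.* x ℚ.+ u ℚ.* y)
  defect x y z a b p r rl≡1 = sym $ begin-equality
    z ℚ.- ((1ℚ ℚ.- (p ℚ.- a) ℚ.* r) ℚ.* x ℚ.+ (p ℚ.- a) ℚ.* r ℚ.* y)
      ≡⟨ solve 6 (λ x y z a p r →
           z :- ((con 1ℚ :- (p :- a) :* r) :* x :+ (p :- a) :* r :* y) :=
           con 1ℚ :* (z :- x) :- r :* ((p :- a) :* (y :- x))) refl x y z a p r ⟩
    1ℚ ℚ.* (z ℚ.- x) ℚ.- r ℚ.* ((p ℚ.- a) ℚ.* (y ℚ.- x))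
      ≡⟨ cong (λ o → o ℚ.* (z ℚ.- x) ℚ.- r ℚ.* ((p ℚ.- a) ℚ.* (y ℚ.- x))) (sym rl≡1) ⟩
    r ℚ.* (b ℚ.- a) ℚ.* (z ℚ.- x) ℚ.- r ℚ.* ((p ℚ.- a) ℚ.* (y ℚ.- x))
      ≡⟨ solve 7 (λ x y z a b p r → r :* (b :- a) :* (z :- x) :- r :* ((p :- a) :* (y :- x)) :=
           r :* ((b :- a) :* (z :- x) :- (p :- a) :* (y :- x))) refl x y z a b p r ⟩
    r ℚ.* ((b ℚ.- a) ℚ.* (z ℚ.- x) ℚ.- (p ℚ.- a) ℚ.* (y ℚ.- x)) ∎
    where open ℚ.≤-Reasoning

  module Collinear (a b p : Point) (A la lb lp : ℝ) (t : ℚ)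
    (shearˣ : ∀ n → (seq lb n ℚ.- seq la n) ℚ.* (seq (proj₁ p) n ℚ.- seq (proj₁ a) n) ℚ.-
                    (seq lp n ℚ.- seq la n) ℚ.* (seq (proj₁ b) n ℚ.- seq (proj₁ a) n) ≡
                    (ℚ.- t) ℚ.* seq A n)
    (shearʸ : ∀ n → (seq lb n ℚ.- seq la n) ℚ.* (seq (proj₂ p) n ℚ.- seq (proj₂ a) n) ℚ.-
                    (seq lp n ℚ.- seq la n) ℚ.* (seq (proj₂ b) n ℚ.- seq (proj₂ a) n) ≡ seq A n)
    (A≈0 : Null (seq A))
    (r : ℝ) (r-inverse : Eventually (λ n → 0ℚ ℚ.≤ seq r n ×
                           seq r n ℚ.* (seq lb n ℚ.- seq la n) ≡ 1ℚ))
    (a<p : Eventually (λ n → seq la n ℚ.< seq lp n))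
    (p<b : Eventually (λ n → seq lp n ℚ.< seq lb n))
    where

    u : ℝ
    u = (lp Real.- la) Real.* r

    u-bounds : Eventually (λ n → 0ℚ ℚ.≤ seq u n × 0ℚ ℚ.≤ 1ℚ ℚ.- seq u n)
    u-bounds = ev-zip
      (λ n (r≥0 , rl≡1) (a<p , p<b) →
        *-nonneg (ℚ.<⇒≤ (gap a<p)) r≥0 ,
        subst (0ℚ ℚ.≤_) (sym (rest (seq la n) (seq lb n) (seq lp n) (seq r n) rl≡1))
          (*-nonneg (ℚ.<⇒≤ (gap p<b)) r≥0))
      r-inverse (ev-× a<p p<b)

    p-on-ab : OnSegment a b p
    p-on-ab = on-segment a b p u u-bounds
      ( null-resp
          (ev-map (λ n (_ , rl≡1) →
            trans (trans (ℚ.*-assoc (seq r n) (ℚ.- t) (seq A n)) (cong (seq r n ℚ.*_) (sym (shearˣ n))))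
              (defect (seq (proj₁ a) n) (seq (proj₁ b) n) (seq (proj₁ p) n) (seq la n) (seq lb n) (seq lp n) (seq r n) rl≡1))
            r-inverse)
          (null-* (r Real.* fromℚ (ℚ.- t)) A≈0)
      , null-resp
          (ev-map (λ n (_ , rl≡1) →
            trans (cong (seq r n ℚ.*_) (sym (shearʸ n)))
              (defect (seq (proj₂ a) n) (seq (proj₂ b) n) (seq (proj₂ p) n) (seq la n) (seq lb n) (seq lp n) (seq r n) rl≡1))
            r-inverse)
          (null-* r A≈0))

-- The parameter of `p` is its relative level between `a` and `b`. By the shear identities the error
-- of this choice is a multiple of the orientation, hence null.
collinear⇒on-segment : ∀ t a b p → Null (seq (orient a b p)) →
  Pos (λ n → seq (level t b) n ℚ.- seq (level t a) n) →
  Eventually (λ n → seq (level t a) n ℚ.< seq (level t p) n) →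
  Eventually (λ n → seq (level t p) n ℚ.< seq (level t b) n) →
  OnSegment a b p
collinear⇒on-segment t a@(ax , ay) b@(bx , by) p@(px , py) A≈0 l>0 a<p p<b =
  Collinear.p-on-ab a b p (orient a b p) (level t a) (level t b) (level t p) t
    (λ n → shear-x t (seq ax n) (seq ay n) (seq bx n) (seq by n) (seq px n) (seq py n))
    (λ n → shear-y t (seq ax n) (seq ay n) (seq bx n) (seq by n) (seq px n) (seq py n))
    A≈0 (proj₁ l⁻¹) (proj₂ l⁻¹) a<p p<b
  where
  l⁻¹ : ∃[ r ] Eventually (λ n → 0ℚ ℚ.≤ seq r n × seq r n ℚ.* (seq (level t b) n ℚ.- seq (level t a) n) ≡ 1ℚ)
  l⁻¹ = reciprocal (level t b Real.- level t a) l>0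

-- Crossing parities of disjoint segments

-- Real inequalities are only decided up to double negation, which is enough
-- since everything is used to refute the existence of a drawing.
Evt : (ℕ → Set) → Set
Evt P = ¬ ¬ Eventually P

evt-map : {P Q : ℕ → Set} → (∀ n → P n → Q n) → Evt P → Evt Q
evt-map f e k = e λ p → k (ev-map f p)

evt-zip : {P Q R : ℕ → Set} → (∀ n → P n → Q n → R n) → Evt P → Evt Q → Evt R
evt-zip f d e k = d λ p → e λ q → k (ev-zip f p q)

-- `true` is the negative sign: for `a` to the left of `b`, a point of negative orientation is below
-- the line, so the Boolean agrees with `side`.
sign : Bool → ℚ
sign true  = ℚ.- 1ℚ
sign false = 1ℚ

HasSign : Bool → (ℕ → ℚ) → Set
HasSign σ f = Pos (λ n → sign σ ℚ.* f n)

some-sign : ∀ x → ¬ Null (seq x) → ¬ ¬ (∃[ σ ] HasSign σ (seq x))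
some-sign x x≉0 k = pos-or-neg (cauchy x) x≉0
  [ (λ p → k (false , pos-resp (λ n → sym (ℚ.*-identityˡ (seq x n))) p))
  , (λ p → k (true  , pos-resp (λ n → solve 1 (λ x → :- x := (:- con 1ℚ) :* x) refl (seq x n)) p)) ]

Disjoint : Point → Point → Point → Point → Set
Disjoint a b p q = ∀ z → OnSegment a b z → ¬ OnSegment p q z

module Sheared (t : ℚ) where

  -- Opaque, since unfolding the rational comparisons is expensive.
  abstract
    left : ℕ → Point → Point → Bool
    left n a b = does (seq (level t a) n ℚ.<? seq (level t b) n)

    -- Whether p is below the line ab.
    side : ℕ → Point → Point → Point → Bool
    side n a b p = does (seq (orient a b p) n ℚ.* (seq (level t b) n ℚ.- seq (level t a) n) ℚ.<? 0ℚ)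

    left-true : ∀ n a b → seq (level t a) n ℚ.< seq (level t b) n → left n a b ≡ true
    left-true n a b = dec-true (seq (level t a) n ℚ.<? seq (level t b) n)

    left-false : ∀ n a b → seq (level t a) n ℚ.< seq (level t b) n → left n b a ≡ false
    left-false n a b a<b = dec-false (seq (level t b) n ℚ.<? seq (level t a) n) (ℚ.<-asym a<b)

    side-decide : ∀ σ n a b p → 0ℚ ℚ.< seq (level t b) n ℚ.- seq (level t a) n →
                  0ℚ ℚ.< sign σ ℚ.* seq (orient a b p) n → side n a b p ≡ σ
    side-decide σ n a b p = decide σ (seq (orient a b p) n) (seq (level t b) n ℚ.- seq (level t a) n)
      where
      decide : ∀ σ A w → 0ℚ ℚ.< w → 0ℚ ℚ.< sign σ ℚ.* A → does (A ℚ.* w ℚ.<? 0ℚ) ≡ σ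
      decide true A w w>0 A<0 = dec-true (A ℚ.* w ℚ.<? 0ℚ) (ungap
        (subst (0ℚ ℚ.<_) (solve 2 (λ A w → (:- con 1ℚ) :* A :* w := con 0ℚ :- A :* w) refl A w) (*-pos A<0 w>0)))
      decide false A w w>0 A>0 = dec-false (A ℚ.* w ℚ.<? 0ℚ)
        (ℚ.<-asym (*-pos (subst (0ℚ ℚ.<_) (ℚ.*-identityˡ A) A>0) w>0))

    -- Reversing the segment negates both the orientation and the level difference, which is why
    -- `side` uses their product.
    side-flip : ∀ n a b p → side n a b p ≡ side n b a p
    side-flip n a@(ax , ay) b@(bx , by) p@(px , py) = cong (λ x → does (x ℚ.<? 0ℚ))
      (trans (neg-neg (seq (orient a b p) n) (seq (level t a) n) (seq (level t b) n))
        (cong (ℚ._* (seq (level t a) n ℚ.- seq (level t b) n))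
          (sym (det-flip (seq ax n) (seq ay n) (seq bx n) (seq by n) (seq px n) (seq py n)))))
      where
      neg-neg : ∀ A a b → A ℚ.* (b ℚ.- a) ≡ (ℚ.- A) ℚ.* (a ℚ.- b)
      neg-neg = solve 3 (λ A a b → A :* (b :- a) := (:- A) :* (a :- b)) refl

  module _ (n : ℕ) where
    open Parity (left n) (side n) public

  infix 4 _≺_

  -- Records rather than synonyms, so that the points can be inferred from them.
  record _≺_ (a b : Point) : Set where
    constructor precedes
    field gap>0 : Pos (λ n → seq (level t b) n ℚ.- seq (level t a) n)
  open _≺_

  record Ordered (n : ℕ) (a b : Point) : Set where
    constructor order
    field
      forth : left n a b ≡ true
      back  : left n b a ≡ false
  open Ordered

  ≺⇒< : ∀ {a b} → a ≺ b → Eventually (λ n → seq (level t a) n ℚ.< seq (level t b) n)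
  ≺⇒< {a} {b} a≺b = ev-map (λ n → ungap {seq (level t a) n} {seq (level t b) n}) (pos⇒0< (gap>0 a≺b))

  ordered : ∀ {a b} → a ≺ b → Eventually (λ n → Ordered n a b)
  ordered {a} {b} a≺b = ev-map (λ n a<b → order (left-true n a b a<b) (left-false n a b a<b)) (≺⇒< a≺b)

  side-sign : ∀ σ {a b p} → a ≺ b → HasSign σ (seq (orient a b p)) →
              Eventually (λ n → side n a b p ≡ σ)
  side-sign σ {a} {b} {p} a≺b A-sign =
    ev-zip (λ n → side-decide σ n a b p) (pos⇒0< (gap>0 a≺b)) (pos⇒0< A-sign)

  -- A null orientation would place `p`, whose level is between those of `a` and `b`, on the segment
  -- itself.
  orient-sign : ∀ {a b p} → a ≺ p → p ≺ b → a ≺ b → ¬ OnSegment a b p →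
                ¬ ¬ (∃[ σ ] HasSign σ (seq (orient a b p)))
  orient-sign {a} {b} {p} a≺p p≺b a≺b p∉ab = some-sign (orient a b p)
    λ A≈0 → p∉ab (collinear⇒on-segment t a b p A≈0 (gap>0 a≺b) (≺⇒< a≺p) (≺⇒< p≺b))

  ≺-trans : ∀ {a b c} → a ≺ b → b ≺ c → a ≺ c
  ≺-trans {a} {b} {c} a≺b b≺c = precedes
    (pos-resp (λ n → telescope (seq (level t a) n) (seq (level t b) n) (seq (level t c) n))
      (pos-+-nonneg (gap>0 a≺b) (ev-map (λ n → ℚ.<⇒≤) (pos⇒0< (gap>0 b≺c)))))
    where
    telescope : ∀ a b c → (b ℚ.- a) ℚ.+ (c ℚ.- b) ≡ c ℚ.- a
    telescope = solve 3 (λ a b c → (b :- a) :+ (c :- b) := c :- a) refl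

  separated-even : ∀ {a b p q} → a ≺ b → b ≺ p → p ≺ q →
                   Eventually (λ n → crossing n a b p q ≡ false)
  separated-even {a} {b} {p} {q} a≺b b≺p p≺q = ev-zip
    (λ n (ap , aq) (bp , bq) → crossing-values n {a} {b} {p} {q}
      (under-outside n {a} {b} {p} (trans (forth ap) (sym (forth bp))))
      (under-outside n {a} {b} {q} (trans (forth aq) (sym (forth bq))))
      (over-outside n {p} {q} {a} (trans (back ap) (sym (back aq))))
      (over-outside n {p} {q} {b} (trans (back bp) (sym (back bq)))))
    (ev-× (ordered a≺p) (ordered (≺-trans a≺p p≺q)))
    (ev-× (ordered b≺p) (ordered (≺-trans b≺p p≺q)))
    where
    a≺p = ≺-trans a≺b b≺p

  private
    scaled-interpolate : ∀ s a b p q n → let l = λ x → seq (level t x) n in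
      (ℚ.- (s ℚ.* seq (orient a b q) n)) ℚ.* (l b ℚ.- l p) ≡
      s ℚ.* seq (orient p q b) n ℚ.* (l b ℚ.- l a) ℚ.+
      s ℚ.* seq (orient a b p) n ℚ.* (l q ℚ.- l b)
    scaled-interpolate s a@(ax , ay) b@(bx , by) p@(px , py) q@(qx , qy) n =
      trans (pull s (seq (orient a b q) n) (seq (level t b) n ℚ.- seq (level t p) n))
        (trans (cong (s ℚ.*_) (interpolate t (seq ax n) (seq ay n) (seq bx n) (seq by n)
            (seq px n) (seq py n) (seq qx n) (seq qy n)))
          (push s (seq (orient p q b) n) (seq (level t b) n ℚ.- seq (level t a) n)
            (seq (orient a b p) n) (seq (level t q) n ℚ.- seq (level t b) n)))
      where
      pull : ∀ s B w → (ℚ.- (s ℚ.* B)) ℚ.* w ≡ s ℚ.* ((ℚ.- B) ℚ.* w)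
      pull = solve 3 (λ s B w → (:- (s :* B)) :* w := s :* ((:- B) :* w)) refl
      push : ∀ s D v A w → s ℚ.* (D ℚ.* v ℚ.+ A ℚ.* w) ≡ s ℚ.* D ℚ.* v ℚ.+ s ℚ.* A ℚ.* w
      push = solve 5 (λ s D v A w → s :* (D :* v :+ A :* w) := s :* D :* v :+ s :* A :* w) refl

    scaled-det-difference : ∀ s a b p q n →
      s ℚ.* seq (orient a b p) n ℚ.- s ℚ.* seq (orient a b q) n ≡
      s ℚ.* seq (orient p q b) n ℚ.+ s ℚ.* seq (orient q p a) n
    scaled-det-difference s a@(ax , ay) b@(bx , by) p@(px , py) q@(qx , qy) n =
      trans (pull s (seq (orient a b p) n) (seq (orient a b q) n))
        (trans (cong (s ℚ.*_) (det-difference (seq ax n) (seq ay n) (seq bx n) (seq by n)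
            (seq px n) (seq py n) (seq qx n) (seq qy n)))
          (ℚ.*-distribˡ-+ s (seq (orient p q b) n) (seq (orient q p a) n)))
      where
      pull : ∀ s A B → s ℚ.* A ℚ.- s ℚ.* B ≡ s ℚ.* (A ℚ.- B)
      pull = solve 3 (λ s A B → s :* A :- s :* B := s :* (A :- B)) refl

  -- Between the levels of `p` and `b` disjoint segments keep their vertical order, so `p` is below
  -- `ab` exactly when `b` is above `pq`, and the two contributions cancel. Equal orientation signs
  -- mean that the order changes, and then the segments meet.
  overlapping-even : ∀ {a b p q} → a ≺ p → p ≺ b → b ≺ q → Disjoint a b p q →
                     Evt (λ n → crossing n a b p q ≡ false)
  overlapping-even {a} {b} {p} {q} a≺p p≺b b≺q disjoint k =
    orient-sign {a} {b} {p} a≺p p≺b (≺-trans a≺p p≺b)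
        (λ p∈ab → disjoint p p∈ab (start-on-segment p q)) λ where
      (σ , A-sign) → orient-sign {p} {q} {b} p≺b b≺q (≺-trans p≺b b≺q)
          (λ b∈pq → disjoint b (end-on-segment a b) b∈pq) λ where
        (τ , D-sign) → compare σ τ A-sign D-sign (σ ≟ᵇ τ)
    where
    compare : ∀ σ τ → HasSign σ (seq (orient a b p)) → HasSign τ (seq (orient p q b)) → Dec (σ ≡ τ) → ⊥
    compare σ .σ A-sign D-sign (yes refl) = disjoint (proj₁ meeting) (proj₁ (proj₂ meeting)) (proj₂ (proj₂ meeting))
      where
      s = sign σ
      signs : Eventually (λ n → s ℚ.* seq (orient a b q) n ℚ.≤ 0ℚ × 0ℚ ℚ.≤ s ℚ.* seq (orient q p a) n)
      signs = ev-zip (λ n (a<p , p<b , b<q) (A>0 , D>0) →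
          overlapping-signs (scaled-interpolate s a b p q n) (scaled-det-difference s a b p q n)
            a<p p<b b<q A>0 D>0)
        (ev-× (≺⇒< a≺p) (ev-× (≺⇒< p≺b) (≺⇒< b≺q))) (ev-× (pos⇒0< A-sign) (pos⇒0< D-sign))
      meeting = segments-meet a b p q s A-sign (ev-map (λ n → proj₁) signs) (ev-map (λ n → proj₂) signs)
        (ev-map (λ n → ℚ.<⇒≤) (pos⇒0< D-sign))
    compare σ τ A-sign D-sign (no σ≢τ) = k (ev-zip
        (λ n ((ap , bp) , (pq , bq) , aq) (A , D) → trans (crossing-values n {a} {b} {p} {q}
          (under-between n {a} {b} {p} (forth ap) (back bp) A)
          (under-outside n {a} {b} {q} (trans (forth aq) (sym (forth bq))))
          (over-outside n {p} {q} {a} (trans (back ap) (sym (back aq))))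
          (over-between n {p} {q} {b} (forth bp) (back bq) D)) (cancel σ τ σ≢τ))
        (ev-× (ev-× (ordered a≺p) (ordered p≺b))
          (ev-× (ev-× (ordered (≺-trans p≺b b≺q)) (ordered b≺q)) (ordered (≺-trans (≺-trans a≺p p≺b) b≺q))))
        (ev-× (side-sign σ {a} {b} {p} (≺-trans a≺p p≺b) A-sign)
              (side-sign τ {p} {q} {b} (≺-trans p≺b b≺q) D-sign)))
      where
      cancel : ∀ σ τ → σ ≢ τ → (σ xor false) xor (false xor not τ) ≡ false
      cancel true  true  σ≢τ = contradiction refl σ≢τ
      cancel true  false σ≢τ = refl
      cancel false true  σ≢τ = refl
      cancel false false σ≢τ = contradiction refl σ≢τ

  -- Only `p` and `q` contribute, and they lie on the same side of `ab`; otherwise `pq` would meet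
  -- `ab`.
  nested-even : ∀ {a b p q} → a ≺ p → p ≺ q → q ≺ b → Disjoint a b p q →
                Evt (λ n → crossing n a b p q ≡ false)
  nested-even {a} {b} {p} {q} a≺p p≺q q≺b disjoint k =
    orient-sign {a} {b} {p} a≺p p≺b a≺b (λ p∈ab → disjoint p p∈ab (start-on-segment p q)) λ where
      (σ , A-sign) → orient-sign {a} {b} {q} a≺q q≺b a≺b (λ q∈ab → disjoint q q∈ab (end-on-segment p q)) λ where
        (τ , B-sign) → compare σ τ A-sign B-sign (σ ≟ᵇ τ)
    where
    a≺q = ≺-trans a≺p p≺q
    p≺b = ≺-trans p≺q q≺b
    a≺b = ≺-trans a≺p p≺b

    opposite : ∀ σ τ x → σ ≢ τ → sign τ ℚ.* x ≡ ℚ.- (sign σ ℚ.* x)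
    opposite true  true  x σ≢τ = contradiction refl σ≢τ
    opposite true  false x σ≢τ = solve 1 (λ x → con 1ℚ :* x := :- ((:- con 1ℚ) :* x)) refl x
    opposite false true  x σ≢τ = solve 1 (λ x → (:- con 1ℚ) :* x := :- (con 1ℚ :* x)) refl x
    opposite false false x σ≢τ = contradiction refl σ≢τ

    compare : ∀ σ τ → HasSign σ (seq (orient a b p)) → HasSign τ (seq (orient a b q)) → Dec (σ ≡ τ) → ⊥
    compare σ τ A-sign B-sign (no σ≢τ) = disjoint (proj₁ meeting) (proj₁ (proj₂ meeting)) (proj₂ (proj₂ meeting))
      where
      s = sign σ
      −B>0 : Eventually (λ n → 0ℚ ℚ.< ℚ.- (s ℚ.* seq (orient a b q) n))
      −B>0 = ev-map (λ n → subst (0ℚ ℚ.<_) (opposite σ τ (seq (orient a b q) n) σ≢τ)) (pos⇒0< B-sign)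
      signs : Eventually (λ n → 0ℚ ℚ.≤ s ℚ.* seq (orient q p a) n × 0ℚ ℚ.≤ s ℚ.* seq (orient p q b) n)
      signs = ev-zip (λ n (a<p , p<q , q<b) (A>0 , −B>0) →
          nested-signs (scaled-interpolate s a b p q n) (scaled-det-difference s a b p q n)
            a<p p<q q<b A>0 −B>0)
        (ev-× (≺⇒< a≺p) (ev-× (≺⇒< p≺q) (≺⇒< q≺b))) (ev-× (pos⇒0< A-sign) −B>0)
      meeting = segments-meet a b p q s A-sign (ev-map (λ n → neg-pos⇒nonpos) −B>0)
        (ev-map (λ n → proj₁) signs) (ev-map (λ n → proj₂) signs)
    compare σ .σ A-sign B-sign (yes refl) = k (ev-zip
        (λ n ((ap , pb) , (aq , qb)) (A , B) → trans (crossing-values n {a} {b} {p} {q}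
          (under-between n {a} {b} {p} (forth ap) (back pb) A)
          (under-between n {a} {b} {q} (forth aq) (back qb) B)
          (over-outside n {p} {q} {a} (trans (back ap) (sym (back aq))))
          (over-outside n {p} {q} {b} (trans (forth pb) (sym (forth qb))))) (cancel σ))
        (ev-× (ev-× (ordered a≺p) (ordered p≺b)) (ev-× (ordered a≺q) (ordered q≺b)))
        (ev-× (side-sign σ {a} {b} {p} a≺b A-sign) (side-sign σ {a} {b} {q} a≺b B-sign)))
      where
      cancel : ∀ σ → (σ xor σ) xor false ≡ false
      cancel true  = refl
      cancel false = refl

  Apart : Point → Point → Set
  Apart a b = ¬ Null (λ n → seq (level t b) n ℚ.- seq (level t a) n)

  compare-levels : ∀ a b → Apart a b → ¬ ¬ (a ≺ b ⊎ b ≺ a)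
  compare-levels a b a#b k = pos-or-neg (cauchy (level t b Real.- level t a)) a#b
    [ (λ p → k (inj₁ (precedes p)))
    , (λ p → k (inj₂ (precedes (pos-resp (λ n → neg-difference (seq (level t a) n) (seq (level t b) n)) p)))) ]
    where
    neg-difference : ∀ a b → ℚ.- (b ℚ.- a) ≡ a ℚ.- b
    neg-difference = solve 2 (λ a b → :- (b :- a) := a :- b) refl

  opposite : ∀ {a b} → a ≺ b ⊎ b ≺ a → Eventually (λ n → left n a b xor left n b a ≡ true)
  opposite (inj₁ a≺b) = ev-map (λ n o → cong₂ _xor_ (forth o) (back o)) (ordered a≺b)
  opposite (inj₂ b≺a) = ev-map (λ n o → cong₂ _xor_ (back o) (forth o)) (ordered b≺a)

  apart⇒opposite : ∀ a b → Apart a b → Evt (λ n → left n a b xor left n b a ≡ true)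
  apart⇒opposite a b a#b k = compare-levels a b a#b (λ c → k (opposite c))

  Even : Point → Point → Point → Point → Set
  Even a b p q = Evt (λ n → crossing n a b p q ≡ false)

  sorted-even : ∀ {a b p q} → a ≺ b → p ≺ q → a ≺ p → Apart b p → Apart b q →
                Disjoint a b p q → Even a b p q
  sorted-even {a} {b} {p} {q} a≺b p≺q a≺p b#p b#q disjoint k = compare-levels b p b#p λ where
    (inj₁ b≺p) → k (separated-even a≺b b≺p p≺q)
    (inj₂ p≺b) → compare-levels b q b#q λ where
      (inj₁ b≺q) → overlapping-even a≺p p≺b b≺q disjoint k
      (inj₂ q≺b) → nested-even a≺p p≺q q≺b disjoint k

  apart-sym : ∀ a b → Apart a b → Apart b a
  apart-sym a b a#b b≈a = a#b (null-resp
    (always λ n → neg-difference (seq (level t a) n) (seq (level t b) n)) (null-neg b≈a))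
    where
    neg-difference : ∀ a b → ℚ.- (a ℚ.- b) ≡ b ℚ.- a
    neg-difference = solve 2 (λ a b → :- (a :- b) := b :- a) refl

  -- If `p` has the smallest level, the segments exchange roles. `crossing` treats them differently,
  -- so the exchange uses the comparisons of all four pairs of ends.
  directed-even : ∀ {a b p q} → a ≺ b → p ≺ q →
                  Apart a p → Apart a q → Apart b p → Apart b q →
                  Disjoint a b p q → Even a b p q
  directed-even {a} {b} {p} {q} a≺b p≺q a#p a#q b#p b#q disjoint k =
    compare-levels a p a#p λ where
      (inj₁ a≺p) → sorted-even a≺b p≺q a≺p b#p b#q disjoint k
      (inj₂ p≺a) → compare-levels a q a#q λ aq → compare-levels b p b#p λ bp → compare-levels b q b#q λ bq →
        sorted-even p≺q a≺b p≺a (apart-sym a q a#q) (apart-sym b q b#q)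
          (λ z z∈pq z∈ab → disjoint z z∈ab z∈pq) λ even →
          k (ev-zip
            (λ n e ((ap , aq) , (bp , bq)) → trans (crossing-swap n a b p q ap aq bp bq) e) even
            (ev-× (ev-× (opposite (inj₂ p≺a)) (opposite aq)) (ev-× (opposite bp) (opposite bq))))

  disjoint-even : ∀ {a b p q} → Apart a b → Apart p q →
                  Apart a p → Apart a q → Apart b p → Apart b q →
                  Disjoint a b p q → Even a b p q
  disjoint-even {a} {b} {p} {q} a#b p#q a#p a#q b#p b#q disjoint k =
    compare-levels a b a#b λ where
      (inj₁ a≺b) → compare-levels p q p#q λ where
        (inj₁ p≺q) → directed-even a≺b p≺q a#p a#q b#p b#q disjoint k
        (inj₂ q≺p) → directed-even a≺b q≺p a#q a#p b#q b#p (flipʳ a b p q disjoint)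
          (k ∘ ev-map (λ n → trans (crossing-flipʳ n a b p q (side-flip n p q))))
      (inj₂ b≺a) → compare-levels p q p#q λ where
        (inj₁ p≺q) → directed-even b≺a p≺q b#p b#q a#p a#q (flipˡ a b p q disjoint)
          (k ∘ ev-map (λ n → trans (crossing-flipˡ n a b p q (side-flip n a b))))
        (inj₂ q≺p) → directed-even b≺a q≺p b#q b#p a#q a#p (flipʳ b a p q (flipˡ a b p q disjoint))
          (k ∘ ev-map (λ n e → trans (crossing-flipˡ n a b p q (side-flip n a b))
                                 (trans (crossing-flipʳ n b a p q (side-flip n p q)) e)))
    where
    flipʳ : ∀ a b p q → Disjoint a b p q → Disjoint a b q p
    flipʳ a b p q d z z∈ab z∈qp = d z z∈ab (segment-flip q p z z∈qp)
    flipˡ : ∀ a b p q → Disjoint a b p q → Disjoint b a p q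
    flipˡ a b p q d z z∈ba z∈pq = d z (segment-flip b a z z∈ba) z∈pq

-- Generic shears

double : ℕ → ℚ
double zero    = 0ℚ
double (suc n) = double n ℚ.+ (1ℚ ℚ.+ 1ℚ)

-- Steps of 2 leave room between the unit-wide strips of the drawing. As shear parameters the same
-- numbers only have to be distinct.
double-gap : ∀ {m n} → m ℕ.< n → double m ℚ.+ 1ℚ ℚ.< double n
double-gap {m} {suc n} (ℕ.s≤s m≤n) with ℕ.m≤n⇒m<n∨m≡n m≤n
... | inj₂ refl = ℚ.+-monoʳ-< (double m) (ungap {1ℚ} (ℚ.positive⁻¹ 1ℚ))
... | inj₁ m<n  = ℚ.<-trans (double-gap m<n)
  (subst (ℚ._< double n ℚ.+ (1ℚ ℚ.+ 1ℚ)) (ℚ.+-identityʳ (double n))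
    (ℚ.+-monoʳ-< (double n) (ℚ.positive⁻¹ (1ℚ ℚ.+ 1ℚ))))

double-mono : ∀ {m n} → m ℕ.< n → double m ℚ.< double n
double-mono {m} m<n = ℚ.<-trans
  (subst (ℚ._< double m ℚ.+ 1ℚ) (ℚ.+-identityʳ (double m))
    (ℚ.+-monoʳ-< (double m) (ℚ.positive⁻¹ 1ℚ)))
  (double-gap m<n)

-- Distinct points share their level under at most one shear.
eventually-apart : ∀ a b → ¬ a ≈ₚ b → Evt (λ m → Sheared.Apart (double m) a b)
eventually-apart a@(ax , ay) b@(bx , by) a≉b k = k (0 , λ m _ m-level → k (suc m , apart m m-level))
  where
  dx dy : ℕ → ℚ
  dx n = seq ax n ℚ.- seq bx n
  dy n = seq ay n ℚ.- seq by n

  difference : ∀ t ax ay bx by → ((bx ℚ.+ t ℚ.* by) ℚ.- (ax ℚ.+ t ℚ.* ay)) ≡ ℚ.- ((ax ℚ.- bx) ℚ.+ t ℚ.* (ay ℚ.- by))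
  difference = solve 5 (λ t ax ay bx by → ((bx :+ t :* by) :- (ax :+ t :* ay)) := :- ((ax :- bx) :+ t :* (ay :- by))) refl

  subtract : ∀ s t x y → ℚ.- (x ℚ.+ s ℚ.* y) ℚ.+ ℚ.- (ℚ.- (x ℚ.+ t ℚ.* y)) ≡ (t ℚ.- s) ℚ.* y
  subtract = solve 4 (λ s t x y → (:- (x :+ s :* y)) :+ (:- (:- (x :+ t :* y))) := (t :- s) :* y) refl

  eliminate : ∀ t x y → ℚ.- (ℚ.- (x ℚ.+ t ℚ.* y)) ℚ.+ ℚ.- (t ℚ.* y) ≡ x
  eliminate = solve 3 (λ t x y → (:- (:- (x :+ t :* y))) :+ (:- (t :* y)) := x) refl

  Same : ℕ → Set
  Same m = Null (λ n → ℚ.- (dx n ℚ.+ double m ℚ.* dy n))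

  same : ∀ m → Null (λ n → seq (level (double m) b) n ℚ.- seq (level (double m) a) n) → Same m
  same m = null-resp (always λ n → difference (double m) (seq ax n) (seq ay n) (seq bx n) (seq by n))

  -- Two coincidences of levels subtract to a nonzero multiple of `dy`; so `dy` is null, then `dx`,
  -- and the points coincide.
  apart : ∀ m → Null (λ n → seq (level (double m) b) n ℚ.- seq (level (double m) a) n) →
          ∀ m′ → m ℕ.< m′ → Sheared.Apart (double m′) a b
  apart m m-level m′ m<m′ m′-level = a≉b (dx≈0 , dy≈0)
    where
    dy≈0 : Null dy
    dy≈0 = null-cancel (λ e → ℚ.<-irrefl (sym e) (gap (double-mono m<m′)))
      (null-resp (always λ n → subtract (double m) (double m′) (dx n) (dy n))
        (null-+ (same m m-level) (null-neg (same m′ m′-level))))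
    dx≈0 : Null dx
    dx≈0 = null-resp (always λ n → eliminate (double m) (dx n) (dy n))
      (null-+ (null-neg (same m m-level)) (null-neg (null-* (fromℚ (double m)) dy≈0)))

-- Eventually in the approximation index, for eventually every shear.
Evt² : (ℕ → ℕ → Set) → Set
Evt² P = Evt (λ m → Evt (P m))

evt²-map : {P Q : ℕ → ℕ → Set} → (∀ m n → P m n → Q m n) → Evt² P → Evt² Q
evt²-map f = evt-map (λ m → evt-map (f m))

infixl 4 _⊛_

_⊛_ : {P Q : ℕ → ℕ → Set} → Evt² (λ m n → P m n → Q m n) → Evt² P → Evt² Q
f ⊛ x = evt-zip (λ m → evt-zip (λ n f x → f x)) f x

¬evt²⊥ : ¬ Evt² (λ _ _ → ⊥)
¬evt²⊥ e = e λ (M , p) → p M ℕ.≤-refl λ (N , q) → q N ℕ.≤-refl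

-- A subdivided complete graph is not plane

module Crossing (m n : ℕ) where
  open Sheared (double m) public using () renaming (left to left′; side to side′)
  open Parity (left′ n) (side′ n) public

module Plane {G : Graph} (D : Drawing G) (noncross : ∀ e f → e ≢ f → ¬ Cross G D e f) where
  open Graph G
  open Drawing D

  vertex-apart : ∀ u v → u ≢ v → Evt (λ m → Sheared.Apart (double m) (pos u) (pos v))
  vertex-apart u v u≢v = eventually-apart (pos u) (pos v) (distinct u v u≢v)

  -- Without a common end, any common point of the two segments is a crossing, so they are disjoint;
  -- all but finitely many slopes separate the levels of the four ends.
  edges-even : ∀ e f → (∀ v → IsEnd G v e → ¬ IsEnd G v f) →
    Evt² (λ m n → Crossing.crossing m n (pos (end₁ e)) (pos (end₂ e)) (pos (end₁ f)) (pos (end₂ f)) ≡ false)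
  edges-even e f no-common = evt-zip
    (λ m (a#b , p#q) ((a#p , a#q) , (b#p , b#q)) →
      Sheared.disjoint-even (double m) a#b p#q a#p a#q b#p b#q
        (λ z z∈e z∈f → noncross e f (λ { refl → no-common (end₁ e) (inj₁ refl) (inj₁ refl) })
          (z , z∈e , z∈f , λ (v , v∈e , v∈f , _) → no-common v v∈e v∈f)))
    (both (vertex-apart _ _ (loopless e)) (vertex-apart _ _ (loopless f)))
    (both (both (vertex-apart _ _ (λ p → no-common _ (inj₁ refl) (inj₁ p)))
                (vertex-apart _ _ (λ p → no-common _ (inj₁ refl) (inj₂ p))))
          (both (vertex-apart _ _ (λ p → no-common _ (inj₂ refl) (inj₁ p)))
                (vertex-apart _ _ (λ p → no-common _ (inj₂ refl) (inj₂ p)))))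
    where
    both : {P Q : ℕ → Set} → Evt P → Evt Q → Evt (λ m → P m × Q m)
    both = evt-zip (λ _ → _,_)

module Subdivision {G : Graph} (D : Drawing (subdivide G))
  (noncross : ∀ e f → e ≢ f → ¬ Cross (subdivide G) D e f) where
  open Graph G
  open Drawing D
  open Plane {subdivide G} D noncross

  edge-path : Edge → Path Point
  edge-path e = path (pos (inj₁ (end₁ e))) (pos (inj₁ (end₂ e))) (pos (inj₂ e))

  paths-even : ∀ e f → (∀ v → IsEnd G v e → ¬ IsEnd G v f) →
    Evt² (λ m n → Crossing.crossing′ m n (edge-path e) (edge-path f) ≡ false)
  paths-even e f no-common =
    evt²-map (λ m n → Crossing.crossing′-even m n (edge-path e) (edge-path f))
      (edges-even (inj₁ e) (inj₁ f) (no-common′ (inj₁ refl) (inj₁ refl)))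
    ⊛ edges-even (inj₁ e) (inj₂ f) (no-common′ (inj₁ refl) (inj₂ refl))
    ⊛ edges-even (inj₂ e) (inj₁ f) (no-common′ (inj₂ refl) (inj₁ refl))
    ⊛ edges-even (inj₂ e) (inj₂ f) (no-common′ (inj₂ refl) (inj₂ refl))
    where
    e≢f : e ≢ f
    e≢f refl = no-common (end₁ e) (inj₁ refl) (inj₁ refl)

    no-common′ : ∀ {x y} → IsEnd G x e → IsEnd G y f → ∀ v →
                 v ≡ inj₁ x ⊎ v ≡ inj₂ e → ¬ (v ≡ inj₁ y ⊎ v ≡ inj₂ f)
    no-common′ x∈e y∈f _ (inj₁ refl) (inj₁ refl) = no-common _ x∈e y∈f
    no-common′ x∈e y∈f _ (inj₂ refl) (inj₂ refl) = e≢f refl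

module _ (k : ℕ) (D : Drawing (subdivide (complete (5 ℕ.+ k))))
  (noncross : ∀ e f → e ≢ f → ¬ Cross (subdivide (complete (5 ℕ.+ k))) D e f) where

  private
    G : Graph
    G = complete (5 ℕ.+ k)
    open Graph G
    open Drawing D
    open Plane {subdivide G} D noncross
    open Subdivision {G} D noncross

    vertex : Fin 5 → Fin (5 ℕ.+ k)
    vertex = _↑ˡ k

    edge : {i j : Fin 5} → i Fin.< j → Edge
    edge {i} {j} i<j = (vertex i , vertex j) , subst₂ ℕ._<_ (sym (Fin.toℕ-↑ˡ i k)) (sym (Fin.toℕ-↑ˡ j k)) i<j

    v : Fin 5 → Point
    v i = pos (inj₁ (vertex i))

    -- The value for i ≥ j is irrelevant.
    b : Fin 5 → Fin 5 → Point
    b i j with i Fin.<? j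
    ... | yes i<j = pos (inj₂ (edge i<j))
    ... | no  _   = v i

    b-edge : {i j : Fin 5} (i<j : i Fin.< j) → b i j ≡ pos (inj₂ (edge i<j))
    b-edge {i} {j} i<j with i Fin.<? j
    ... | yes p  = cong (λ p → pos (inj₂ (edge p))) (Fin.<-irrelevant p i<j)
    ... | no i≮j = contradiction i<j i≮j

    module K (m n : ℕ) = K₅
      (λ i j p → Crossing.under′ m n (path (v i) (v j) (b i j)) (v p))
      (λ i j p → Crossing.over′ m n (path (v i) (v j) (b i j)) (v p))
      (λ i j → Sheared.left (double m) n (v i) (v j))
      (λ i j p → Crossing.under′≡over′ m n (path (v i) (v j) (b i j)) (v p))

    independent? : (i j k l : Fin 5) → Dec ((i Fin.< j × k Fin.< l) × (i ≢ k × i ≢ l × j ≢ k × j ≢ l))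
    independent? i j k l =
      (i Fin.<? j ×-dec k Fin.<? l) ×-dec
      (¬? (i Fin.≟ k) ×-dec ¬? (i Fin.≟ l) ×-dec ¬? (j Fin.≟ k) ×-dec ¬? (j Fin.≟ l))

    even : ∀ i j k l {_ : True (independent? i j k l)} → Evt² (λ m n → K.Even m n i j k l)
    even i j k l {ind} with toWitness ind
    ... | (i<j , k<l) , i≢k , i≢l , j≢k , j≢l =
      subst₂ (λ x y → Evt² (λ m n → Crossing.crossing′ m n (path (v i) (v j) x) (path (v k) (v l) y) ≡ false))
        (sym (b-edge i<j)) (sym (b-edge k<l))
        (paths-even (edge i<j) (edge k<l) no-common)
      where
      no-common : ∀ u → IsEnd G u (edge i<j) → ¬ IsEnd G u (edge k<l)
      no-common u (inj₁ refl) (inj₁ p) = i≢k (Fin.↑ˡ-injective _ i k p)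
      no-common u (inj₁ refl) (inj₂ p) = i≢l (Fin.↑ˡ-injective _ i l p)
      no-common u (inj₂ refl) (inj₁ p) = j≢k (Fin.↑ˡ-injective _ j k p)
      no-common u (inj₂ refl) (inj₂ p) = j≢l (Fin.↑ˡ-injective _ j l p)

    opposite : ∀ i j {_ : True (¬? (i Fin.≟ j))} → Evt² (λ m n → K.Opposite m n i j)
    opposite i j {i≢j} = evt-map
      (λ m → Sheared.apart⇒opposite (double m) (v i) (v j))
      (vertex-apart (inj₁ (vertex i)) (inj₁ (vertex j))
        (λ p → toWitness i≢j (Fin.↑ˡ-injective k i j (inj₁-injective p))))

  not-plane : ⊥
  not-plane = ¬evt²⊥
    ( evt²-map (λ m n → K.K₅-nonplanar m n 0F 1F 2F 3F 4F) (even 0F 1F 2F 3F)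
    ⊛ even 0F 1F 2F 4F ⊛ even 0F 1F 3F 4F
    ⊛ even 0F 2F 1F 3F ⊛ even 0F 2F 1F 4F ⊛ even 0F 2F 3F 4F
    ⊛ even 0F 3F 1F 2F ⊛ even 0F 3F 1F 4F ⊛ even 0F 3F 2F 4F
    ⊛ even 0F 4F 1F 2F ⊛ even 0F 4F 1F 3F ⊛ even 0F 4F 2F 3F
    ⊛ even 1F 2F 3F 4F ⊛ even 1F 3F 2F 4F ⊛ even 1F 4F 2F 3F
    ⊛ opposite 3F 2F ⊛ opposite 4F 2F ⊛ opposite 4F 3F)

-- The drawing in two layers

null-const : ∀ {d} → Null (const d) → d ≡ 0ℚ
null-const {d} d≈0 = ℚ.≤-antisym
  (ℚ.≮⇒≥ (λ d>0 → ¬limit≤0-const d>0 (null⇒limit≤0 d≈0)))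
  (ℚ.≮⇒≥ (λ d<0 → ¬limit≤0-const (ℚ.neg-antimono-< d<0) (null⇒limit≤0 (null-neg d≈0))))

fromℚ-injective : ∀ {p q} → fromℚ p Real.≈ fromℚ q → p ≡ q
fromℚ-injective {p} {q} p≈q = x∙y⁻¹≈ε⇒x≈y p q (null-const p≈q)

centre : ℚ → Point
centre a = fromℚ a , fromℚ (ℚ.- a)

tip : ℚ → ℚ → Point
tip a b = fromℚ (a ℚ.+ 1ℚ) , fromℚ (b ℚ.+ 1ℚ)

-- A spoke has horizontal extent 1, so its parameter `t` is the horizontal distance from the centre,
-- and its slope `a + b + 1` determines `b`.
record OnSpoke (a b : ℚ) (z : Point) : Set where
  field
    t     : ℝ
    t≥0   : Limit≤0 (λ n → 0ℚ ℚ.- seq t n)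
    t≤1   : Limit≤0 (λ n → seq t n ℚ.- 1ℚ)
    x≈    : Null (λ n → seq (proj₁ z) n ℚ.- (a ℚ.+ seq t n))
    y≈    : Null (λ n → seq (proj₂ z) n ℚ.- (seq t n ℚ.* (a ℚ.+ b ℚ.+ 1ℚ) ℚ.- a))
open OnSpoke

on-spoke : ∀ a b z → OnSegment (centre a) (tip a b) z → OnSpoke a b z
on-spoke a b (x , y) (t , t≥0 , t≤1 , x≈ , y≈) = record
  { t = t ; t≥0 = t≥0 ; t≤1 = t≤1
  ; x≈ = null-resp (always λ n → ex a (seq t n) (seq x n)) x≈
  ; y≈ = null-resp (always λ n → ey a b (seq t n) (seq y n)) y≈
  }
  where
  ex : ∀ a t x → x ℚ.- ((1ℚ ℚ.- t) ℚ.* a ℚ.+ t ℚ.* (a ℚ.+ 1ℚ)) ≡ x ℚ.- (a ℚ.+ t)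
  ex = solve 3 (λ a t x → x :- ((con 1ℚ :- t) :* a :+ t :* (a :+ con 1ℚ)) := x :- (a :+ t)) refl
  ey : ∀ a b t y → y ℚ.- ((1ℚ ℚ.- t) ℚ.* (ℚ.- a) ℚ.+ t ℚ.* (b ℚ.+ 1ℚ)) ≡
                   y ℚ.- (t ℚ.* (a ℚ.+ b ℚ.+ 1ℚ) ℚ.- a)
  ey = solve 4 (λ a b t y → y :- ((con 1ℚ :- t) :* (:- a) :+ t :* (b :+ con 1ℚ)) :=
                            y :- (t :* (a :+ b :+ con 1ℚ) :- a)) refl

-- A fan with centre a lies in the strip a ≤ x ≤ a + 1.
strips-ordered : ∀ {a b a′ b′ z} → OnSpoke a b z → OnSpoke a′ b′ z → ¬ a ℚ.+ 1ℚ ℚ.< a′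
strips-ordered {a} {b} {a′} {b′} {z} s s′ a+1<a′ = ¬limit≤0-const (gap a+1<a′)
  (limit≤0-resp (always λ n → e a a′ (seq (t s) n) (seq (t s′) n) (seq (proj₁ z) n))
    (limit≤0-+ (limit≤0-+ (t≤1 s) (t≥0 s′))
      (null⇒limit≤0 (null-+ (x≈ s) (null-neg (x≈ s′))))))
  where
  e : ∀ a a′ t t′ x → ((t ℚ.- 1ℚ) ℚ.+ (0ℚ ℚ.- t′)) ℚ.+ ((x ℚ.- (a ℚ.+ t)) ℚ.+ ℚ.- (x ℚ.- (a′ ℚ.+ t′))) ≡
                      a′ ℚ.- (a ℚ.+ 1ℚ)
  e = solve 5 (λ a a′ t t′ x → ((t :- con 1ℚ) :+ (con 0ℚ :- t′)) :+ ((x :- (a :+ t)) :+ (:- (x :- (a′ :+ t′)))) :=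
                      a′ :- (a :+ con 1ℚ)) refl

at-centre : ∀ {a b z} (s : OnSpoke a b z) → Null (seq (t s)) → z ≈ₚ centre a
at-centre {a} {b} {x , y} s t≈0 =
  null-resp (always λ n → ex a (seq (t s) n) (seq x n)) (null-+ (x≈ s) t≈0) ,
  null-resp (always λ n → ey a (a ℚ.+ b ℚ.+ 1ℚ) (seq (t s) n) (seq y n))
    (null-+ (y≈ s) (null-* (fromℚ (a ℚ.+ b ℚ.+ 1ℚ)) t≈0))
  where
  ex : ∀ a t x → x ℚ.- (a ℚ.+ t) ℚ.+ t ≡ x ℚ.- a
  ex = solve 3 (λ a t x → x :- (a :+ t) :+ t := x :- a) refl
  ey : ∀ a c t y → y ℚ.- (t ℚ.* c ℚ.- a) ℚ.+ c ℚ.* t ≡ y ℚ.- (ℚ.- a)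
  ey = solve 4 (λ a c t y → y :- (t :* c :- a) :+ c :* t := y :- (:- a)) refl

-- Equal first coordinates give equal parameters, and at parameter `t` the heights of the two spokes
-- differ by `(b - b′) * t`; hence `t` is null.
spokes-meet-at-centre : ∀ {a b b′ z} → OnSpoke a b z → OnSpoke a b′ z → b ≢ b′ → z ≈ₚ centre a
spokes-meet-at-centre {a} {b} {b′} {x , y} s s′ b≢b′ = at-centre s (null-cancel b-b′≢0
  (null-resp (always λ n → e a b b′ (seq (t s) n) (seq (t s′) n) (seq x n) (seq y n))
    (null-+ (null-+ (y≈ s′) (null-neg (y≈ s)))
      (null-* (fromℚ (a ℚ.+ b′ ℚ.+ 1ℚ)) (null-+ (x≈ s) (null-neg (x≈ s′)))))))
  where
  b-b′≢0 : b ℚ.- b′ ≢ 0ℚ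
  b-b′≢0 p = b≢b′ (x∙y⁻¹≈ε⇒x≈y b b′ p)
  e : ∀ a b b′ t t′ x y → let c = a ℚ.+ b ℚ.+ 1ℚ ; c′ = a ℚ.+ b′ ℚ.+ 1ℚ in
      (y ℚ.- (t′ ℚ.* c′ ℚ.- a)) ℚ.+ ℚ.- (y ℚ.- (t ℚ.* c ℚ.- a)) ℚ.+
      c′ ℚ.* ((x ℚ.- (a ℚ.+ t)) ℚ.+ ℚ.- (x ℚ.- (a ℚ.+ t′))) ≡ (b ℚ.- b′) ℚ.* t
  e = solve 7 (λ a b b′ t t′ x y → let c = a :+ b :+ con 1ℚ ; c′ = a :+ b′ :+ con 1ℚ in
      (y :- (t′ :* c′ :- a)) :+ (:- (y :- (t :* c :- a))) :+
      c′ :* ((x :- (a :+ t)) :+ (:- (x :- (a :+ t′)))) := (b :- b′) :* t) refl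

Spaced : {I : Set} → (I → ℚ) → Set
Spaced c = ∀ i j → i ≢ j → c i ℚ.+ 1ℚ ℚ.< c j ⊎ c j ℚ.+ 1ℚ ℚ.< c i

below-next : ∀ a → a ℚ.< a ℚ.+ 1ℚ
below-next a = subst (ℚ._< a ℚ.+ 1ℚ) (ℚ.+-identityʳ a) (ℚ.+-monoʳ-< a (ℚ.positive⁻¹ 1ℚ))

spaced-injective : ∀ {I : Set} {c : I → ℚ} → Spaced c → ∀ i j → i ≢ j → c i ≢ c j
spaced-injective spaced i j i≢j e with spaced i j i≢j
... | inj₁ p = ℚ.<-irrefl e (ℚ.<-trans (below-next _) p)
... | inj₂ p = ℚ.<-irrefl (sym e) (ℚ.<-trans (below-next _) p)

-- Keeps tips and centres distinct by their first coordinates alone.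
spaced-not-next : ∀ {I : Set} {c : I → ℚ} → Spaced c → DecidableEquality I → ∀ i j → c i ≢ c j ℚ.+ 1ℚ
spaced-not-next {c = c} spaced _≟_ i j e with i ≟ j
... | yes refl = ℚ.<-irrefl e (below-next (c i))
... | no i≢j with spaced i j i≢j
... | inj₁ p = ℚ.<-asym (below-next (c j)) (subst (ℚ._< c j) e (ℚ.<-trans (below-next (c i)) p))
... | inj₂ p = ℚ.<-irrefl (sym e) p

-- Which end of an edge is near and which coordinate comes first are left open, so that the
-- reflected family is a second instance.
module Fans {I E : Set} (_≟_ : DecidableEquality I) (near far : E → I)
  (ends-determine : ∀ e f → near e ≡ near f → far e ≡ far f → e ≡ f)
  (c d : I → ℚ) (c-spaced : Spaced c) (d-spaced : Spaced d) where

  at : I ⊎ E → Point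
  at (inj₁ i) = centre (c i)
  at (inj₂ e) = tip (c (near e)) (d (far e))

  Spoke : E → Point → Set
  Spoke e = OnSegment (at (inj₁ (near e))) (at (inj₂ e))

  same-centre : ∀ {i j b b′ z} → OnSpoke (c i) b z → OnSpoke (c j) b′ z → i ≡ j
  same-centre {i} {j} s s′ with i ≟ j
  ... | yes i≡j = i≡j
  ... | no i≢j with c-spaced i j i≢j
  ... | inj₁ p = contradiction p (strips-ordered s s′)
  ... | inj₂ p = contradiction p (strips-ordered s′ s)

  meet-at-centre : ∀ e f z → e ≢ f → Spoke e z → Spoke f z →
                   near e ≡ near f × z ≈ₚ at (inj₁ (near e))
  meet-at-centre e f z e≢f z∈e z∈f = near≡ , spokes-meet-at-centre s
      (subst (λ i → OnSpoke (c i) _ z) (sym near≡) s′)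
      (spaced-injective d-spaced _ _ (λ far≡ → e≢f (ends-determine e f near≡ far≡)))
    where
    s = on-spoke (c (near e)) (d (far e)) z z∈e
    s′ = on-spoke (c (near f)) (d (far f)) z z∈f
    near≡ : near e ≡ near f
    near≡ = same-centre s s′

  tip-not-centre : ∀ e i → ¬ at (inj₂ e) ≈ₚ at (inj₁ i)
  tip-not-centre e i (p , _) = spaced-not-next c-spaced _≟_ i (near e) (sym (fromℚ-injective p))

  spoke-avoids : ∀ e v → v ≢ inj₁ (near e) → v ≢ inj₂ e → ¬ Spoke e (at v)
  -- The centre is regarded as the start of a spoke with an arbitrarily chosen tip, so that the
  -- comparison of strips applies to it.
  spoke-avoids e (inj₁ i) v≢ _ v∈e = v≢ (cong inj₁ (same-centre
    (on-spoke (c i) (c i) (centre (c i)) (start-on-segment (centre (c i)) (tip (c i) (c i))))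
    (on-spoke (c (near e)) (d (far e)) (centre (c i)) v∈e)))
  -- A foreign tip on the spoke of `e` would be common to the spokes of `e` and `f`, hence equal to
  -- a centre.
  spoke-avoids e (inj₂ f) _ v≢ v∈e = tip-not-centre f (near e)
    (proj₂ (meet-at-centre e f (at (inj₂ f)) (λ e≡f → v≢ (cong inj₂ (sym e≡f))) v∈e
      (end-on-segment (at (inj₁ (near f))) (at (inj₂ f)))))

  at-injective : ∀ u v → u ≢ v → ¬ at u ≈ₚ at v
  at-injective (inj₁ i) (inj₁ j) u≢v (p , _) =
    spaced-injective c-spaced i j (u≢v ∘ cong inj₁) (fromℚ-injective p)
  at-injective (inj₁ i) (inj₂ f) u≢v (p , _) =
    spaced-not-next c-spaced _≟_ i (near f) (fromℚ-injective p)
  at-injective (inj₂ e) (inj₁ j) u≢v = tip-not-centre e j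
  at-injective (inj₂ e) (inj₂ f) u≢v (p , q) with near e ≟ near f
  ... | no near≢ = spaced-injective c-spaced _ _ near≢ (∙-cancelʳ 1ℚ _ _ (fromℚ-injective p))
  ... | yes near≡ = spaced-injective d-spaced _ _
    (λ far≡ → u≢v (cong inj₂ (ends-determine e f near≡ far≡)))
    (∙-cancelʳ 1ℚ _ _ (fromℚ-injective q))

module TwoLayers (k : ℕ) where

  private
    G H : Graph
    G = complete k
    H = subdivide G
    open Graph G

    x y : Fin k → ℚ
    x i = double (toℕ i)
    y i = ℚ.- x i

    x-spaced : Spaced x
    x-spaced i j i≢j with Fin.<-cmp i j
    ... | tri< i<j _ _ = inj₁ (double-gap i<j)
    ... | tri≈ _ i≡j _ = contradiction i≡j i≢j
    ... | tri> _ _ j<i = inj₂ (double-gap j<i)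

    reflect : ∀ p q → p ℚ.+ 1ℚ ℚ.< q → ℚ.- q ℚ.+ 1ℚ ℚ.< ℚ.- p
    reflect p q h = subst (ℚ.- q ℚ.+ 1ℚ ℚ.<_)
      (solve 1 (λ p → (:- (p :+ con 1ℚ)) :+ con 1ℚ := :- p) refl p)
      (ℚ.+-monoˡ-< 1ℚ (ℚ.neg-antimono-< h))

    y-spaced : Spaced y
    y-spaced i j i≢j with x-spaced i j i≢j
    ... | inj₁ p = inj₂ (reflect (x i) (x j) p)
    ... | inj₂ p = inj₁ (reflect (x j) (x i) p)

    ends-determine : ∀ e f → end₁ e ≡ end₁ f → end₂ e ≡ end₂ f → e ≡ f
    ends-determine e f p q = Graph.simple G e f (inj₁ (p , q))

    module Vertical   = Fans Fin._≟_ end₁ end₂ ends-determine x y x-spaced y-spaced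
    module Horizontal = Fans Fin._≟_ end₂ end₁ (λ e f p q → ends-determine e f q p) y x y-spaced x-spaced

    position : Graph.Vertex H → Point
    position = Vertical.at

    -- Exchanging the coordinates exchanges the two families of fans.
    swap-position : ∀ v → swap (position v) ≡ Horizontal.at v
    swap-position (inj₁ i) = cong (λ p → fromℚ (y i) , fromℚ p) (sym (⁻¹-involutive (x i)))
    swap-position (inj₂ e) = refl

    swap-segment : ∀ a b z → OnSegment a b z → OnSegment (swap a) (swap b) (swap z)
    swap-segment _ _ _ (t , t≥0 , t≤1 , z≈) = t , t≥0 , t≤1 , swap z≈

    horizontal : ∀ e z → OnSegment (position (inj₁ (end₂ e))) (position (inj₂ e)) z →
                 Horizontal.Spoke e (swap z)
    horizontal e z z∈e = subst₂ (λ a b → OnSegment a b (swap z))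
      (swap-position (inj₁ (end₂ e))) (swap-position (inj₂ e)) (swap-segment (position (inj₁ (end₂ e))) (position (inj₂ e)) z z∈e)

  drawing : LayeredDrawing H 2
  drawing = record
    { drawing = D ; layer = [ const 0F , const 1F ] ; noncross = noncross }
    where
    D : Drawing H
    D = record { pos = position ; distinct = Vertical.at-injective ; avoids = avoids }
      where
      avoids : ∀ e v → ¬ IsEnd H v e → ¬ OnEdge H position e (position v)
      avoids (inj₁ e) v v∉e = Vertical.spoke-avoids e v (v∉e ∘ inj₁) (v∉e ∘ inj₂)
      avoids (inj₂ e) v v∉e v∈e = Horizontal.spoke-avoids e v (v∉e ∘ inj₁) (v∉e ∘ inj₂)
        (subst (Horizontal.Spoke e) (swap-position v) (horizontal e (position v) v∈e))

    noncross : ∀ e f → e ≢ f → [ const 0F , const 1F ] e ≡ [ const 0F , const 1F ] f → ¬ Cross H D e f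
    noncross (inj₁ e) (inj₁ f) e≢f _ (z , z∈e , z∈f , no-common) =
      let near≡ , z≈ = Vertical.meet-at-centre e f z (e≢f ∘ cong inj₁) z∈e z∈f
      in no-common (inj₁ (end₁ e) , inj₁ refl , inj₁ (cong inj₁ near≡) , z≈)
    noncross (inj₁ _) (inj₂ _) _ ()
    noncross (inj₂ _) (inj₁ _) _ ()
    noncross (inj₂ e) (inj₂ f) e≢f _ (z , z∈e , z∈f , no-common) =
      let near≡ , z≈ = Horizontal.meet-at-centre e f (swap z) (e≢f ∘ cong inj₂) (horizontal e z z∈e) (horizontal f z z∈f)
      in no-common (inj₁ (end₂ e) , inj₁ refl , inj₁ (cong inj₁ near≡) ,
           swap (subst (swap z ≈ₚ_) (sym (swap-position (inj₁ (end₂ e)))) z≈))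

theorem1 : (k : ℕ) → 5 ≤ k → GeometricThickness (subdivide (complete k)) 2
theorem1 _ (s≤s (s≤s (s≤s (s≤s (s≤s (z≤n {k})))))) = TwoLayers.drawing _ , minimal
  where
  open LayeredDrawing

  minimal : ∀ m → LayeredDrawing (subdivide (complete (5 ℕ.+ k))) m → 2 ≤ m
  minimal zero L with () ← layer L (inj₁ ((0F , 1F) , s≤s z≤n))
  minimal (suc zero) L = contradiction
    (λ e f e≢f → noncross L e f e≢f (only (layer L e) (layer L f))) (not-plane k (drawing L))
    where
    only : (i j : Fin 1) → i ≡ j
    only 0F 0F = refl
  minimal (suc (suc m)) L = s≤s (s≤s z≤n)
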